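{- The inequality $\mathrm{C}(y\mid x*)\le \mathrm{C}'(y\mid x*)+c$ holds for some constant $c$ and for all binary strings $x,y$. The reverse inequality does not hold: there exist binary strings $x_i,y_i$ (for $i=0,1,2,\ldots$) such that $\mathrm{C}(y_i\mid x_i*)$ is bounded while $\mathrm{C}'(y_i\mid x_i*)$ is unbounded.
   Context: A description mode is a set $D$ of triples $(p,x,y)$ of binary strings such that: (1) $D$ is computably enumerable; (2) for every $p$ and $x$ there is at most one $y$ such that $(p,x,y)\in D$; (3) if $(p,x,y)\in D$ and $x$ is a prefix of $x'$, then $(p,x',y)\in D$. For a description mode $D$ let $\mathrm{C}_D(y\mid x*)=\min\{|p| : (p,x,y)\in D\}$. There exists an optimal description mode, i.e., a $D$ such that $\mathrm{C}_D\le \mathrm{C}_{D'}+O(1)$ for every description mode $D'$; fix such a $D$ and write $\mathrm{C}(y\mid x*)$ for $\mathrm{C}_D(y\mid x*)$. A partial function $f$ from binary strings to binary strings is prefix-free if its domain is prefix-free, i.e., $f$ is never defined on a string and a proper extension of it at the same time. $\mathrm{C}'(y\mid x*)$ is the minimal plain Kolmogorov complexity of a program that computes a prefix-free partial function mapping some prefix of $x$ (possibly $x$ itself) to $y$. Programs are binary strings in a fixed standard programming language, and plain complexity is taken with respect to a fixed optimal decompressor. -}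

module Defs where

open import Data.Bool using (Bool; true; false)
open import Data.List using (List; []; _∷_; length)
open import Data.List.Relation.Binary.Prefix.Heterogeneous using (Prefix)
open import Data.Nat using (ℕ; _+_; _≤_)
open import Data.Nat.Properties using (≤-trans; ≤-refl; +-monoˡ-≤)
open import Data.Product using (∃; ∃-syntax; _×_; _,_)
open import Data.Sum using (_⊎_; inj₁; inj₂)
open import Data.Unit using (⊤; tt)
open import Function.Bundles using (_⇔_; mk⇔)
open import Relation.Binary.PropositionalEquality using (_≡_; _≢_; refl)
open import Relation.Nullary using (¬_)

-- Model of computation: partial recursive functions on first-order data,
-- i.e. the closure of the structural operations under composition, primitive
-- recursion on lists, and unbounded iteration.  Natural numbers are list unit.

infixr 6 _⊕_
infixr 7 _⊗_

data Ty : Set where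
  unit bit : Ty
  _⊕_ _⊗_  : Ty → Ty → Ty
  list     : Ty → Ty

⟦_⟧ : Ty → Set
⟦ unit ⟧   = ⊤
⟦ bit ⟧    = Bool
⟦ A ⊕ B ⟧  = ⟦ A ⟧ ⊎ ⟦ B ⟧
⟦ A ⊗ B ⟧  = ⟦ A ⟧ × ⟦ B ⟧
⟦ list A ⟧ = List ⟦ A ⟧

str : Ty
str = list bit

Str : Set
Str = List Bool

infixr 9 _∘_

data Fn : Ty → Ty → Set where
  id     : ∀ {A} → Fn A A
  _∘_    : ∀ {A B C} → Fn B C → Fn A B → Fn A C
  unit!  : ∀ {A} → Fn A unit
  ⟨_,_⟩  : ∀ {A B C} → Fn A B → Fn A C → Fn A (B ⊗ C)
  fst    : ∀ {A B} → Fn (A ⊗ B) A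
  snd    : ∀ {A B} → Fn (A ⊗ B) B
  bit!   : ∀ {A} → Bool → Fn A bit
  if     : ∀ {Γ C} → Fn Γ C → Fn Γ C → Fn (Γ ⊗ bit) C
  inl    : ∀ {A B} → Fn A (A ⊕ B)
  inr    : ∀ {A B} → Fn B (A ⊕ B)
  case   : ∀ {Γ A B C} → Fn (Γ ⊗ A) C → Fn (Γ ⊗ B) C → Fn (Γ ⊗ (A ⊕ B)) C
  nil    : ∀ {A B} → Fn A (list B)
  cons   : ∀ {A} → Fn (A ⊗ list A) (list A)
  rec    : ∀ {Γ A B} → Fn Γ B → Fn (Γ ⊗ A ⊗ list A ⊗ B) B → Fn (Γ ⊗ list A) B
  -- iterate the body while it returns a left value
  loop   : ∀ {A B} → Fn A (A ⊕ B) → Fn A B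

infix 4 _·_⇓_

-- f · a ⇓ b : f halts on a with result b.
data _·_⇓_ : ∀ {A B} → Fn A B → ⟦ A ⟧ → ⟦ B ⟧ → Set where
  id      : ∀ {A} {a : ⟦ A ⟧} → id {A} · a ⇓ a
  comp    : ∀ {A B C} {g : Fn B C} {f : Fn A B} {a b c} →
            f · a ⇓ b → g · b ⇓ c → g ∘ f · a ⇓ c
  unit!   : ∀ {A} {a : ⟦ A ⟧} → unit! {A} · a ⇓ tt
  pair    : ∀ {A B C} {f : Fn A B} {g : Fn A C} {a b c} →
            f · a ⇓ b → g · a ⇓ c → ⟨ f , g ⟩ · a ⇓ (b , c)
  fst     : ∀ {A B} {a : ⟦ A ⟧} {b : ⟦ B ⟧} → fst {A} {B} · (a , b) ⇓ a
  snd     : ∀ {A B} {a : ⟦ A ⟧} {b : ⟦ B ⟧} → snd {A} {B} · (a , b) ⇓ b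
  bit!    : ∀ {A v} {a : ⟦ A ⟧} → bit! {A} v · a ⇓ v
  if-t    : ∀ {Γ C} {f g : Fn Γ C} {γ c} → f · γ ⇓ c → if f g · (γ , true) ⇓ c
  if-f    : ∀ {Γ C} {f g : Fn Γ C} {γ c} → g · γ ⇓ c → if f g · (γ , false) ⇓ c
  inl     : ∀ {A B} {a : ⟦ A ⟧} → inl {A} {B} · a ⇓ inj₁ a
  inr     : ∀ {A B} {b : ⟦ B ⟧} → inr {A} {B} · b ⇓ inj₂ b
  case-l  : ∀ {Γ A B C} {f : Fn (Γ ⊗ A) C} {g : Fn (Γ ⊗ B) C} {γ a c} →
            f · (γ , a) ⇓ c → case f g · (γ , inj₁ a) ⇓ c
  case-r  : ∀ {Γ A B C} {f : Fn (Γ ⊗ A) C} {g : Fn (Γ ⊗ B) C} {γ b c} →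
            g · (γ , b) ⇓ c → case f g · (γ , inj₂ b) ⇓ c
  nil     : ∀ {A B} {a : ⟦ A ⟧} → nil {A} {B} · a ⇓ []
  cons    : ∀ {A} {a : ⟦ A ⟧} {as} → cons {A} · (a , as) ⇓ (a ∷ as)
  rec-[]  : ∀ {Γ A B} {f : Fn Γ B} {g : Fn (Γ ⊗ A ⊗ list A ⊗ B) B} {γ b} →
            f · γ ⇓ b → rec f g · (γ , []) ⇓ b
  rec-∷   : ∀ {Γ A B} {f : Fn Γ B} {g : Fn (Γ ⊗ A ⊗ list A ⊗ B) B} {γ a as b c} →
            rec f g · (γ , as) ⇓ b → g · (γ , a , as , b) ⇓ c →
            rec f g · (γ , a ∷ as) ⇓ c
  again   : ∀ {A B} {f : Fn A (A ⊕ B)} {a a′ b} →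
            f · a ⇓ inj₁ a′ → loop f · a′ ⇓ b → loop f · a ⇓ b
  done    : ∀ {A B} {f : Fn A (A ⊕ B)} {a b} →
            f · a ⇓ inj₂ b → loop f · a ⇓ b

⇓-deterministic : ∀ {A B} {f : Fn A B} {a b c} → f · a ⇓ b → f · a ⇓ c → b ≡ c
⇓-deterministic id id = refl
⇓-deterministic (comp p q) (comp p′ q′) with refl ← ⇓-deterministic p p′ = ⇓-deterministic q q′
⇓-deterministic unit! unit! = refl
⇓-deterministic (pair p q) (pair p′ q′)
  with refl ← ⇓-deterministic p p′ | refl ← ⇓-deterministic q q′ = refl
⇓-deterministic fst fst = refl
⇓-deterministic snd snd = refl
⇓-deterministic bit! bit! = refl
⇓-deterministic (if-t p) (if-t p′) = ⇓-deterministic p p′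
⇓-deterministic (if-f p) (if-f p′) = ⇓-deterministic p p′
⇓-deterministic inl inl = refl
⇓-deterministic inr inr = refl
⇓-deterministic (case-l p) (case-l p′) = ⇓-deterministic p p′
⇓-deterministic (case-r p) (case-r p′) = ⇓-deterministic p p′
⇓-deterministic nil nil = refl
⇓-deterministic cons cons = refl
⇓-deterministic (rec-[] p) (rec-[] p′) = ⇓-deterministic p p′
⇓-deterministic (rec-∷ p q) (rec-∷ p′ q′) with refl ← ⇓-deterministic p p′ = ⇓-deterministic q q′
⇓-deterministic (again p q) (again p′ q′) with refl ← ⇓-deterministic p p′ = ⇓-deterministic q q′
⇓-deterministic (again p _) (done p′) with () ← ⇓-deterministic p p′
⇓-deterministic (done p) (again p′ _) with () ← ⇓-deterministic p p′
⇓-deterministic (done p) (done p′) with refl ← ⇓-deterministic p p′ = refl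

_↓_ : ∀ {A B} → Fn A B → ⟦ A ⟧ → Set
f ↓ a = ∃[ b ] f · a ⇓ b

ComputablyEnumerable : ∀ {A} → (⟦ A ⟧ → Set) → Set
ComputablyEnumerable {A} S = ∃[ f ] (∀ a → S a ⇔ (_↓_ {A} {unit} f a))

-- A complexity is the minimum of a set of lengths.  Such a minimum cannot be
-- computed, so a complexity is represented by the set S itself, and
-- inequalities are stated for min S (with min ∅ = ∞).  The lemmas after the
-- definitions check this against the actual least element.

Lengths : Set₁
Lengths = ℕ → Set

infix 4 min_≤_ min_≤min_+_

min_≤_ : Lengths → ℕ → Set
min S ≤ n = ∃[ m ] S m × m ≤ n

min_≤min_+_ : Lengths → Lengths → ℕ → Set
min S ≤min T + c = ∀ n → min T ≤ n → min S ≤ (n + c)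

IsMin : Lengths → ℕ → Set
IsMin S m = S m × (∀ k → S k → m ≤ k)

min-≤-correct : ∀ {S m} → IsMin S m → ∀ n → (min S ≤ n) ⇔ (m ≤ n)
min-≤-correct (s , least) n =
  mk⇔ (λ (k , sk , k≤n) → ≤-trans (least k sk) k≤n) (λ m≤n → _ , s , m≤n)

min-≤min-correct : ∀ {S T m n} → IsMin S m → IsMin T n →
                   ∀ c → (min S ≤min T + c) ⇔ (m ≤ n + c)
min-≤min-correct {S} {T} {m} {n} (s , leastS) (t , leastT) c = mk⇔ to from
  where
  to : min S ≤min T + c → m ≤ n + c
  to h with h n (n , t , ≤-refl)
  ... | k , sk , k≤ = ≤-trans (leastS k sk) k≤
  from : m ≤ n + c → min S ≤min T + c
  from m≤ j (k , tk , k≤j) =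
    m , s , ≤-trans m≤ (+-monoˡ-≤ c (≤-trans (leastT k tk) k≤j))

Bounded : (ℕ → Lengths) → Set
Bounded K = ∃[ b ] (∀ i → min K i ≤ b)

-- Not ∀ b → ∃[ i ] ¬ (min K i ≤ b): proved constructively, that makes i
-- computable from b, so that for complexities the i-th object could be described
-- with only about log b bits.
Unbounded : (ℕ → Lengths) → Set
Unbounded K = ¬ Bounded K

_isPrefixOf_ : Str → Str → Set
_isPrefixOf_ = Prefix _≡_

record DescriptionMode : Set₁ where
  field
    D          : Str × Str × Str → Set
    enumerable : ComputablyEnumerable {str ⊗ str ⊗ str} D
    functional : ∀ {p x y y′} → D (p , x , y) → D (p , x , y′) → y ≡ y′
    stable     : ∀ {p x x′ y} → x isPrefixOf x′ → D (p , x , y) → D (p , x′ , y)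

C[_] : DescriptionMode → Str → Str → Lengths
C[ M ] y x n = ∃[ p ] DescriptionMode.D M (p , x , y) × length p ≡ n

OptimalMode : DescriptionMode → Set₁
OptimalMode M = ∀ M′ → ∃[ c ] (∀ x y → min C[ M ] y x ≤min C[ M′ ] y x + c)

PlainC[_] : Fn str str → Str → Lengths
PlainC[ V ] q n = ∃[ p ] V · p ⇓ q × length p ≡ n

OptimalDecompressor : Fn str str → Set
OptimalDecompressor V = ∀ V′ → ∃[ c ] (∀ q → min PlainC[ V ] q ≤min PlainC[ V′ ] q + c)

-- U · (q , x) ⇓ y : program q maps x to y.  A programming language is standard
-- when programs of any other language translate into it computably (an
-- acceptable, or Gödel, numbering).
StandardLanguage : Fn (str ⊗ str) str → Set
StandardLanguage U = ∀ (W : Fn (str ⊗ str) str) → ∃[ t ] (∀ p → ∃[ q ]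
  (_·_⇓_ {str} {str} t p q × (∀ x y → (W · (p , x) ⇓ y) ⇔ (U · (q , x) ⇓ y))))

PrefixFree : Fn (str ⊗ str) str → Str → Set
PrefixFree U q = ∀ {u v} → u isPrefixOf v → u ≢ v → ¬ (U ↓ (q , u) × U ↓ (q , v))

-- The minimum over programs q of the minimum PlainC[ V ] q is the minimum of
-- the union over q.
C′[_,_] : Fn (str ⊗ str) str → Fn str str → Str → Str → Lengths
C′[ U , V ] y x n = ∃[ q ] PrefixFree U q
                         × (∃[ z ] z isPrefixOf x × U · (q , z) ⇓ y)
                         × PlainC[ V ] q n

{-# OPTIONS --safe #-}

-- Both parts concern the partial function G (p , z) = U (V p , z).
--
-- Upper bound: fix an enumeration of all pairs (z , t) and accept a value of
-- G (p , _) found at argument z within t steps only if no earlier pair gave a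
-- value at an argument comparable with z.  Accepted arguments are pairwise
-- incomparable, so prefixes of one x yield at most one value; nothing is lost
-- when V p is prefix-free.
--
-- Separation: for each b a strategy enumerates declarations "x and its
-- extensions have value y" against all p with |p| ≤ b.  It starts with
-- x = a 0^k and y = a, where a = 1^b 0 keeps different b apart and k counts
-- these p, and waits until some p gives y at a prefix z of x.  If z = x, it
-- declares y also at x without its last bit, where p, being prefix-free, can no
-- longer give y.  Otherwise it takes the sibling of x, which still extends z,
-- as the new a, so that p is excluded for good.  Either can happen only
-- finitely often, hence some declaration is never covered.
module Submission where

open import Defs
open import Data.Bool using (Bool; true; false; if_then_else_; not; _∧_; _∨_)
open import Data.List using (List; []; _∷_; _∷ʳ_; _++_; length; filter; reverse; replicate)
open import Data.List.Membership.Propositional using (_∈_; lose)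
open import Data.List.Membership.Propositional.Properties using (∈-filter⁺; ∈-filter⁻)
open import Data.List.Properties
  using (++-assoc; ++-identityʳ; length-++; length-replicate; unfold-reverse; reverse-involutive; filter-notAll)
open import Data.List.Relation.Binary.Prefix.Heterogeneous using ([]; _∷_)
open import Data.List.Relation.Binary.Prefix.Heterogeneous.Properties using (length-mono)
open import Data.List.Relation.Unary.Any using (here; there)
open import Data.Nat using (ℕ; zero; suc; _+_; _⊔_; _≤_; _<_; z≤n; s≤s; s≤s⁻¹)
open import Data.Nat.Properties
  using ( ≤-refl; ≤-reflexive; ≤-trans; ≤-total; <⇒≤; <-≤-trans; ≤-<-trans; <-irrefl; <-cmp; n≤1+n; n<1+n
        ; m<n⇒m<1+n; m≤n⇒m<n∨m≡n; m≤m⊔n; m≤n⊔m; +-comm; +-monoˡ-<; suc-injective)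
open import Data.Product using (∃-syntax; Σ-syntax; _×_; _,_; proj₁; proj₂)
open import Data.Sum using (_⊎_; inj₁; inj₂; [_,_])
open import Data.Sum.Properties using (inj₂-injective)
open import Data.Unit using (⊤; tt)
open import Function.Bundles using (_⇔_; mk⇔)
open import Relation.Binary using (tri<; tri≈; tri>)
open import Relation.Binary.PropositionalEquality using (_≡_; _≢_; refl; sym; trans; cong; subst)
open import Relation.Nullary
  using (¬_; Dec; yes; no; does; proof; contradiction; _because_; ¬?; Reflects; ofʸ; ofⁿ)
open import Relation.Nullary.Decidable using (map)
open import Relation.Nullary.Reflects using (_×-reflects_; _⊎-reflects_; ¬-reflects)

private variable
  A B Γ E : Ty
  p z a : Str
  ps us vs : List Str

-- Total functions paired with codes that compute them

record Computable {A B : Ty} (f : ⟦ A ⟧ → ⟦ B ⟧) : Set where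
  constructor _by_
  field
    code    : Fn A B
    correct : ∀ a → code · a ⇓ f a


-- Correctness of a code is a pointwise statement, so pointwise equality suffices in place of
-- function extensionality. This lets library functions be computed through folds.
computable-≗ : {f g : ⟦ A ⟧ → ⟦ B ⟧} → (∀ a → f a ≡ g a) → Computable f → Computable g
computable-≗ f≗g (F by c) = F by λ a → subst (F · a ⇓_) (f≗g a) (c a)

idᶜ : Computable {A} {A} (λ a → a)
idᶜ = id by λ _ → id

fstᶜ : Computable {A ⊗ B} {A} (λ (a , b) → a)
fstᶜ = fst by λ _ → fst

sndᶜ : Computable {A ⊗ B} {B} (λ (a , b) → b)
sndᶜ = snd by λ _ → snd

infixr 9 _∘ᶜ_
_∘ᶜ_ : {g : ⟦ B ⟧ → ⟦ E ⟧} {f : ⟦ A ⟧ → ⟦ B ⟧} →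
       Computable g → Computable f → Computable (λ a → g (f a))
_∘ᶜ_ {f = f} (G by d) (F by c) = (G ∘ F) by λ a → comp (c a) (d (f a))

infixr 4 _,ᶜ_
_,ᶜ_ : {f : ⟦ A ⟧ → ⟦ B ⟧} {g : ⟦ A ⟧ → ⟦ E ⟧} →
       Computable f → Computable g → Computable {A} {B ⊗ E} (λ a → f a , g a)
(F by c) ,ᶜ (G by d) = ⟨ F , G ⟩ by λ a → pair (c a) (d a)

ttᶜ : Computable {A} {unit} (λ _ → tt)
ttᶜ = unit! by λ _ → unit!

bitᶜ : (v : Bool) → Computable {A} {bit} (λ _ → v)
bitᶜ v = bit! v by λ _ → bit!

[]ᶜ : Computable {A} {list B} (λ _ → [])
[]ᶜ = nil by λ _ → nil

infixr 5 _∷ᶜ_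
_∷ᶜ_ : {f : ⟦ A ⟧ → ⟦ B ⟧} {g : ⟦ A ⟧ → ⟦ list B ⟧} →
       Computable f → Computable g → Computable {A} {list B} (λ a → f a ∷ g a)
cf ∷ᶜ cg = (cons by λ _ → cons) ∘ᶜ (cf ,ᶜ cg)

inj₁ᶜ : {f : ⟦ Γ ⟧ → ⟦ A ⟧} → Computable f → Computable {Γ} {A ⊕ B} (λ γ → inj₁ (f γ))
inj₁ᶜ cf = (inl by λ _ → inl) ∘ᶜ cf

inj₂ᶜ : {f : ⟦ Γ ⟧ → ⟦ B ⟧} → Computable f → Computable {Γ} {A ⊕ B} (λ γ → inj₂ (f γ))
inj₂ᶜ cf = (inr by λ _ → inr) ∘ᶜ cf

ifᶜ : {b : ⟦ Γ ⟧ → Bool} {f g : ⟦ Γ ⟧ → ⟦ A ⟧} →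
      Computable {Γ} {bit} b → Computable f → Computable g →
      Computable {Γ} {A} (λ γ → if b γ then f γ else g γ)
ifᶜ {b = b} {f} {g} (H by e) (F by c) (G by d) = (if F G ∘ ⟨ id , H ⟩) by λ γ →
  comp (pair id (e γ)) (branch γ (b γ))
  where
  branch : ∀ γ v → if F G · (γ , v) ⇓ (if v then f γ else g γ)
  branch γ true  = if-t (c γ)
  branch γ false = if-f (d γ)

caseᶜ : {s : ⟦ Γ ⟧ → ⟦ A ⟧ ⊎ ⟦ B ⟧}
        {f : ⟦ Γ ⟧ → ⟦ A ⟧ → ⟦ E ⟧} {g : ⟦ Γ ⟧ → ⟦ B ⟧ → ⟦ E ⟧} →
        Computable {Γ} {A ⊕ B} s →
        Computable {Γ ⊗ A} {E} (λ (γ , a) → f γ a) →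
        Computable {Γ ⊗ B} {E} (λ (γ , b) → g γ b) →
        Computable {Γ} {E} (λ γ → [ f γ , g γ ] (s γ))
caseᶜ {s = s} {f} {g} (H by e) (F by c) (G by d) = (case F G ∘ ⟨ id , H ⟩) by λ γ →
  comp (pair id (e γ)) (branch γ (s γ))
  where
  branch : ∀ γ v → case F G · (γ , v) ⇓ [ f γ , g γ ] v
  branch γ (inj₁ a) = case-l (c (γ , a))
  branch γ (inj₂ b) = case-r (d (γ , b))

-- The paramorphism on lists, the semantic counterpart of `rec`: the step also sees the tail.
para : {X Y : Set} → (X → List X → Y → Y) → Y → List X → Y
para c n []       = n
para c n (x ∷ xs) = c x xs (para c n xs)

paraᶜ : {g : ⟦ Γ ⟧ → ⟦ A ⟧ → List ⟦ A ⟧ → ⟦ B ⟧ → ⟦ B ⟧} {f : ⟦ Γ ⟧ → ⟦ B ⟧} {xs : ⟦ Γ ⟧ → List ⟦ A ⟧} →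
        Computable {Γ ⊗ A ⊗ list A ⊗ B} {B} (λ (γ , a , as , b) → g γ a as b) →
        Computable f → Computable {Γ} {list A} xs →
        Computable {Γ} {B} (λ γ → para (g γ) (f γ) (xs γ))
paraᶜ {g = g} {f} {xs} (G by d) (F by c) (H by e) = (rec F G ∘ ⟨ id , H ⟩) by λ γ →
  comp (pair id (e γ)) (fold γ (xs γ))
  where
  fold : ∀ γ as → rec F G · (γ , as) ⇓ para (g γ) (f γ) as
  fold γ []       = rec-[] (c γ)
  fold γ (a ∷ as) = rec-∷ (fold γ as) (d (γ , a , as , _))

-- Step-bounded evaluation

-- Unary numbers in the form of the interpretation of `list unit`, so that step bounds and indices
-- are themselves data of the model.
Fuel : Set
Fuel = List ⊤

infixl 1 _>>=_
_>>=_ : {X Y : Set} → ⊤ ⊎ X → (X → ⊤ ⊎ Y) → ⊤ ⊎ Y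
m >>= k = [ (λ _ → inj₁ tt) , k ] m

bindᶜ : {m : ⟦ Γ ⟧ → ⊤ ⊎ ⟦ A ⟧} {k : ⟦ Γ ⟧ → ⟦ A ⟧ → ⊤ ⊎ ⟦ B ⟧} →
        Computable {Γ} {unit ⊕ A} m → Computable {Γ ⊗ A} {unit ⊕ B} (λ (γ , a) → k γ a) →
        Computable {Γ} {unit ⊕ B} (λ γ → m γ >>= k γ)
bindᶜ cm ck = caseᶜ cm (inj₁ᶜ ttᶜ) ck

iterate : {X : Set} → (X → X) → Fuel → X → X
iterate f k s = para (λ _ _ → f) s k

module Loop {X Y : Set} (f : X → ⊤ ⊎ (X ⊎ Y)) where
  step : ⊤ ⊎ (X ⊎ Y) → ⊤ ⊎ (X ⊎ Y)
  step s = s >>= [ f , (λ y → inj₂ (inj₂ y)) ]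

  output : ⊤ ⊎ (X ⊎ Y) → ⊤ ⊎ Y
  output s = s >>= [ (λ _ → inj₁ tt) , inj₂ ]

open Loop

-- The same fuel serves every subprogram, and only `loop` uses it, as its number of rounds. A result
-- `inj₁ tt` means that the fuel was too small.
run : Fn A B → Fuel → ⟦ A ⟧ → ⊤ ⊎ ⟦ B ⟧
run id         t a        = inj₂ a
run (g ∘ f)    t a        = run f t a >>= run g t
run unit!      t a        = inj₂ tt
run ⟨ f , g ⟩  t a        = run f t a >>= λ b → run g t a >>= λ c → inj₂ (b , c)
run fst        t (a , b)  = inj₂ a
run snd        t (a , b)  = inj₂ b
run (bit! v)   t a        = inj₂ v
run (if f g)   t (γ , v)  = if v then run f t γ else run g t γ
run inl        t a        = inj₂ (inj₁ a)
run inr        t b        = inj₂ (inj₂ b)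
run (case f g) t (γ , s)  = [ (λ a → run f t (γ , a)) , (λ b → run g t (γ , b)) ] s
run nil        t a        = inj₂ []
run cons       t (a , as) = inj₂ (a ∷ as)
run (rec f g)  t (γ , as) =
  para (λ a as r → r >>= λ b → run g t (γ , a , as , b)) (run f t γ) as
run (loop f)   t a        = output (run f t) (iterate (step (run f t)) t (inj₂ (inj₁ a)))

-- Bounded evaluation of each fixed code is again computed by a code; this allows searches over
-- arguments and step counts at once.
runᶜ : (f : Fn A B) → Computable {A ⊗ list unit} {unit ⊕ B} (λ (a , t) → run f t a)
runᶜ id = inj₂ᶜ fstᶜ
runᶜ (g ∘ f) = bindᶜ (runᶜ f) (runᶜ g ∘ᶜ (sndᶜ ,ᶜ sndᶜ ∘ᶜ fstᶜ))
runᶜ unit! = inj₂ᶜ ttᶜ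
runᶜ ⟨ f , g ⟩ = bindᶜ (runᶜ f) (bindᶜ (runᶜ g ∘ᶜ fstᶜ) (inj₂ᶜ (sndᶜ ∘ᶜ fstᶜ ,ᶜ sndᶜ)))
runᶜ fst = inj₂ᶜ (fstᶜ ∘ᶜ fstᶜ)
runᶜ snd = inj₂ᶜ (sndᶜ ∘ᶜ fstᶜ)
runᶜ (bit! v) = inj₂ᶜ (bitᶜ v)
runᶜ (if f g) = ifᶜ (sndᶜ ∘ᶜ fstᶜ) (runᶜ f ∘ᶜ (fstᶜ ∘ᶜ fstᶜ ,ᶜ sndᶜ)) (runᶜ g ∘ᶜ (fstᶜ ∘ᶜ fstᶜ ,ᶜ sndᶜ))
runᶜ inl = inj₂ᶜ (inj₁ᶜ fstᶜ)
runᶜ inr = inj₂ᶜ (inj₂ᶜ fstᶜ)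
runᶜ (case f g) = caseᶜ (sndᶜ ∘ᶜ fstᶜ)
  (runᶜ f ∘ᶜ ((fstᶜ ∘ᶜ fstᶜ ∘ᶜ fstᶜ ,ᶜ sndᶜ) ,ᶜ sndᶜ ∘ᶜ fstᶜ))
  (runᶜ g ∘ᶜ ((fstᶜ ∘ᶜ fstᶜ ∘ᶜ fstᶜ ,ᶜ sndᶜ) ,ᶜ sndᶜ ∘ᶜ fstᶜ))
runᶜ nil = inj₂ᶜ []ᶜ
runᶜ cons = inj₂ᶜ ((fstᶜ ∘ᶜ fstᶜ) ∷ᶜ (sndᶜ ∘ᶜ fstᶜ))
runᶜ (rec f g) = paraᶜ
  (bindᶜ (sndᶜ ∘ᶜ sndᶜ ∘ᶜ sndᶜ)
         (runᶜ g ∘ᶜ ((fstᶜ ∘ᶜ fstᶜ ∘ᶜ fstᶜ ∘ᶜ fstᶜ ,ᶜ fstᶜ ∘ᶜ sndᶜ ∘ᶜ fstᶜ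
                      ,ᶜ fstᶜ ∘ᶜ sndᶜ ∘ᶜ sndᶜ ∘ᶜ fstᶜ ,ᶜ sndᶜ)
                     ,ᶜ sndᶜ ∘ᶜ fstᶜ ∘ᶜ fstᶜ)))
  (runᶜ f ∘ᶜ (fstᶜ ∘ᶜ fstᶜ ,ᶜ sndᶜ))
  (sndᶜ ∘ᶜ fstᶜ)
runᶜ (loop f) = bindᶜ
  (paraᶜ (bindᶜ (sndᶜ ∘ᶜ sndᶜ ∘ᶜ sndᶜ)
                (caseᶜ sndᶜ (runᶜ f ∘ᶜ (sndᶜ ,ᶜ sndᶜ ∘ᶜ fstᶜ ∘ᶜ fstᶜ ∘ᶜ fstᶜ))
                            (inj₂ᶜ (inj₂ᶜ sndᶜ))))
         (inj₂ᶜ (inj₁ᶜ fstᶜ)) sndᶜ)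
  (caseᶜ sndᶜ (inj₁ᶜ ttᶜ) (inj₂ᶜ sndᶜ))

>>=-inv : {X Y : Set} (m : ⊤ ⊎ X) {k : X → ⊤ ⊎ Y} {y : Y} →
          (m >>= k) ≡ inj₂ y → ∃[ x ] m ≡ inj₂ x × k x ≡ inj₂ y
>>=-inv (inj₂ x) eq = x , refl , eq

module _ {f : Fn A (A ⊕ B)} where

  -- `iterate` adds rounds at the end, whereas `again` adds them at the front. A running state
  -- therefore carries a continuation that turns a derivation from the present state into one from
  -- the initial state.
  data Reaches (a : ⟦ A ⟧) : ⊤ ⊎ (⟦ A ⟧ ⊎ ⟦ B ⟧) → Set where
    failed   : Reaches a (inj₁ tt)
    running  : ∀ {a′} → (∀ {b} → loop f · a′ ⇓ b → loop f · a ⇓ b) → Reaches a (inj₂ (inj₁ a′))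
    finished : ∀ {b} → loop f · a ⇓ b → Reaches a (inj₂ (inj₂ b))

Sound : Fn A B → Fuel → Set
Sound {A} {B} f t = ∀ {a : ⟦ A ⟧} {b : ⟦ B ⟧} → run f t a ≡ inj₂ b → f · a ⇓ b

rec-sound : {f : Fn Γ B} {g : Fn (Γ ⊗ A ⊗ list A ⊗ B) B} {t : Fuel} → Sound f t → Sound g t →
            ∀ γ as {b} → run (rec f g) t (γ , as) ≡ inj₂ b → rec f g · (γ , as) ⇓ b
rec-sound sf sg γ []       eq = rec-[] (sf eq)
rec-sound {f = f} {g} {t} sf sg γ (a ∷ as) eq
  with b , p , q ← >>=-inv (run (rec f g) t (γ , as)) eq = rec-∷ (rec-sound sf sg γ as p) (sg q)

iterate-sound : {f : Fn A (A ⊕ B)} {t : Fuel} → Sound f t → (k : Fuel) (a : ⟦ A ⟧) →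
                Reaches {f = f} a (iterate (Loop.step (run f t)) k (inj₂ (inj₁ a)))
iterate-sound sf [] a = running λ d → d
iterate-sound {f = f} {t} sf (_ ∷ k) a
  with iterate (Loop.step (run f t)) k (inj₂ (inj₁ a)) | iterate-sound sf k a
... | _ | failed = failed
... | _ | finished d = finished d
... | _ | running {a′} r with run f t a′ in eq
...   | inj₁ tt = failed
...   | inj₂ (inj₁ a″) = running λ d → r (again (sf eq) d)
...   | inj₂ (inj₂ b) = finished (r (done (sf eq)))

run-sound : (f : Fn A B) (t : Fuel) → Sound f t
run-sound id t refl = id
run-sound (g ∘ f) t {a} eq with b , p , q ← >>=-inv (run f t a) eq =
  comp (run-sound f t p) (run-sound g t q)
run-sound unit! t refl = unit!
run-sound ⟨ f , g ⟩ t {a} eq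
  with b , p , eq′ ← >>=-inv (run f t a) eq
  with c , q , refl ← >>=-inv (run g t a) eq′ = pair (run-sound f t p) (run-sound g t q)
run-sound fst t refl = fst
run-sound snd t refl = snd
run-sound (bit! v) t refl = bit!
run-sound (if f g) t {γ , true} eq = if-t (run-sound f t eq)
run-sound (if f g) t {γ , false} eq = if-f (run-sound g t eq)
run-sound inl t refl = inl
run-sound inr t refl = inr
run-sound (case f g) t {γ , inj₁ a} eq = case-l (run-sound f t eq)
run-sound (case f g) t {γ , inj₂ b} eq = case-r (run-sound g t eq)
run-sound nil t refl = nil
run-sound cons t refl = cons
run-sound (rec f g) t {γ , as} eq = rec-sound (run-sound f t) (run-sound g t) γ as eq
run-sound (loop f) t {a} eq
  with iterate (Loop.step (run f t)) t (inj₂ (inj₁ a)) | iterate-sound {t = t} (run-sound f t) t a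
run-sound (loop f) t refl | _ | finished d = d

-- Asking for all large fuels lets two subcomputations share one fuel, by the larger threshold.
Eventually : (Fuel → Set) → Set
Eventually P = ∃[ N ] ∀ t → N ≤ length t → P t

always : {P : Fuel → Set} → (∀ t → P t) → Eventually P
always p = 0 , λ t _ → p t

ev-zip : {P Q R : Fuel → Set} → (∀ {t} → P t → Q t → R t) →
         Eventually P → Eventually Q → Eventually R
ev-zip f (M , p) (N , q) = M ⊔ N , λ t h →
  f (p t (≤-trans (m≤m⊔n M N) h)) (q t (≤-trans (m≤n⊔m M N) h))

iterate-step : {X : Set} (f : X → X) (k : Fuel) (s : X) → f (iterate f k s) ≡ iterate f k (f s)
iterate-step f []      s = refl
iterate-step f (_ ∷ k) s = cong f (iterate-step f k s)

iterate-fixed : {X : Set} {f : X → X} (k : Fuel) {s : X} → f s ≡ s → iterate f k s ≡ s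
iterate-fixed []      eq = refl
iterate-fixed {f = f} (_ ∷ k) eq = trans (cong f (iterate-fixed k eq)) eq

run-complete : {f : Fn A B} {a : ⟦ A ⟧} {b : ⟦ B ⟧} → f · a ⇓ b →
               Eventually (λ t → run f t a ≡ inj₂ b)
-- The body's fuel `t` and the number `k` of rounds are separated, since only the latter decreases
-- along the loop.
iterate-complete : {f : Fn A (A ⊕ B)} {a : ⟦ A ⟧} {b : ⟦ B ⟧} → loop f · a ⇓ b →
  ∃[ N ] ∀ t k → N ≤ length t → N ≤ length k →
    iterate (Loop.step (run f t)) k (inj₂ (inj₁ a)) ≡ inj₂ (inj₂ b)

run-complete id = always λ _ → refl
run-complete (comp {g = g} d e) =
  ev-zip (λ {t} p q → trans (cong (_>>= run g t) p) q) (run-complete d) (run-complete e)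
run-complete unit! = always λ _ → refl
run-complete (pair {g = g} {a = a} d e) =
  ev-zip (λ {t} p q → trans (cong (_>>= λ b → run g t a >>= λ c → inj₂ (b , c)) p)
                            (cong (_>>= λ c → inj₂ (_ , c)) q))
         (run-complete d) (run-complete e)
run-complete fst = always λ _ → refl
run-complete snd = always λ _ → refl
run-complete bit! = always λ _ → refl
run-complete (if-t d) = run-complete d
run-complete (if-f d) = run-complete d
run-complete inl = always λ _ → refl
run-complete inr = always λ _ → refl
run-complete (case-l d) = run-complete d
run-complete (case-r d) = run-complete d
run-complete nil = always λ _ → refl
run-complete cons = always λ _ → refl
run-complete (rec-[] d) = run-complete d
run-complete (rec-∷ {g = g} {γ} {a} {as} d e) =
  ev-zip (λ {t} p q → trans (cong (_>>= λ b → run g t (γ , a , as , b)) p) q)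
         (run-complete d) (run-complete e)
run-complete {f = loop f} d@(again _ _) with N , p ← iterate-complete d =
  N , λ t h → cong (Loop.output (run f t)) (p t t h h)
run-complete {f = loop f} d@(done _) with N , p ← iterate-complete d =
  N , λ t h → cong (Loop.output (run f t)) (p t t h h)

iterate-complete {f = f} {a} (again {a′ = a′} d e)
  with M , p ← run-complete d | N , q ← iterate-complete e =
  suc (M ⊔ N) , λ where
    t (_ ∷ k) M⊔N<t (s≤s M⊔N≤k) →
      let M⊔N≤t = ≤-trans (n≤1+n _) M⊔N<t in
      trans (iterate-step (Loop.step (run f t)) k _)
        (trans (cong (iterate (Loop.step (run f t)) k) (p t (≤-trans (m≤m⊔n M N) M⊔N≤t)))
               (q t k (≤-trans (m≤n⊔m M N) M⊔N≤t) (≤-trans (m≤n⊔m M N) M⊔N≤k)))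
iterate-complete {f = f} {a} (done d) with M , p ← run-complete d =
  suc M , λ where
    t (_ ∷ k) M<t (s≤s _) →
      trans (iterate-step (Loop.step (run f t)) k _)
        (trans (cong (iterate (Loop.step (run f t)) k) (p t (≤-trans (n≤1+n _) M<t)))
               (iterate-fixed {f = Loop.step (run f t)} k refl))

-- Predicates decided by codes

record Decidableᶜ {A : Ty} (P : ⟦ A ⟧ → Set) : Set where
  field
    {χ}      : ⟦ A ⟧ → Bool
    computes : Computable {A} {bit} χ
    reflects : ∀ a → Reflects (P a) (χ a)

  decide : ∀ a → Dec (P a)
  decide a = χ a because reflects a

open Decidableᶜ

⇔ᵈ : {P Q : ⟦ A ⟧ → Set} → (∀ a → P a ⇔ Q a) → Decidableᶜ P → Decidableᶜ Q
⇔ᵈ P⇔Q d = record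
  { computes = computes d ; reflects = λ a → proof (map (P⇔Q a) (decide d a)) }

infixr 9 _∘ᵈ_
_∘ᵈ_ : {P : ⟦ B ⟧ → Set} {f : ⟦ A ⟧ → ⟦ B ⟧} →
       Decidableᶜ P → Computable f → Decidableᶜ {A} (λ a → P (f a))
_∘ᵈ_ {f = f} d cf = record { computes = computes d ∘ᶜ cf ; reflects = λ a → reflects d (f a) }

infixr 3 _×ᵈ_
_×ᵈ_ : {P Q : ⟦ A ⟧ → Set} → Decidableᶜ P → Decidableᶜ Q → Decidableᶜ (λ a → P a × Q a)
c ×ᵈ d = record
  { computes = computable-≗ (λ a → if-∧ (χ c a) (χ d a))
                            (ifᶜ (computes c) (computes d) (bitᶜ false))
  ; reflects = λ a → reflects c a ×-reflects reflects d a }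
  where
  if-∧ : ∀ u v → (if u then v else false) ≡ u ∧ v
  if-∧ true  v = refl
  if-∧ false v = refl

infixr 2 _⊎ᵈ_
_⊎ᵈ_ : {P Q : ⟦ A ⟧ → Set} → Decidableᶜ P → Decidableᶜ Q → Decidableᶜ (λ a → P a ⊎ Q a)
c ⊎ᵈ d = record
  { computes = computable-≗ (λ a → if-∨ (χ c a) (χ d a))
                            (ifᶜ (computes c) (bitᶜ true) (computes d))
  ; reflects = λ a → reflects c a ⊎-reflects reflects d a }
  where
  if-∨ : ∀ u v → (if u then true else v) ≡ u ∨ v
  if-∨ true  v = refl
  if-∨ false v = refl

¬ᵈ : {P : ⟦ A ⟧ → Set} → Decidableᶜ P → Decidableᶜ (λ a → ¬ P a)
¬ᵈ c = record
  { computes = computable-≗ (λ a → if-not (χ c a)) (ifᶜ (computes c) (bitᶜ false) (bitᶜ true))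
  ; reflects = λ a → ¬-reflects (reflects c a) }
  where
  if-not : ∀ u → (if u then false else true) ≡ not u
  if-not true  = refl
  if-not false = refl

unary-injective : (m n : Fuel) → length m ≡ length n → m ≡ n
unary-injective []       []       _  = refl
unary-injective (_ ∷ m) (_ ∷ n) eq = cong (tt ∷_) (unary-injective m n (suc-injective eq))

below-or-top : {P : Fuel → Set} (n : Fuel) → (∀ m → length m < length n → P m) → P n →
               ∀ m → length m < length (tt ∷ n) → P m
below-or-top {P} n below top m m<1+n with m≤n⇒m<n∨m≡n (s≤s⁻¹ m<1+n)
... | inj₁ m<n = below m m<n
... | inj₂ m≡n = subst P (unary-injective n m (sym m≡n)) top

-- The bounded quantifier ranges over numbers, that is, unary lists compared by length.
∀<ᵈ : {P : ⟦ A ⟧ → Fuel → Set} → Decidableᶜ {A ⊗ list unit} (λ (a , n) → P a n) →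
      Decidableᶜ {A ⊗ list unit} (λ (a , n) → ∀ m → length m < length n → P a m)
∀<ᵈ {A} {P} d = record
  { computes = paraᶜ (ifᶜ (computes d ∘ᶜ (fstᶜ ∘ᶜ fstᶜ ,ᶜ fstᶜ ∘ᶜ sndᶜ ∘ᶜ sndᶜ)) (sndᶜ ∘ᶜ sndᶜ ∘ᶜ sndᶜ) (bitᶜ false))
                     (bitᶜ true) sndᶜ
  ; reflects = λ (a , n) → correctness a n }
  where
  below : ⟦ A ⟧ → Fuel → Bool
  below a n = para (λ _ n r → if χ d (a , n) then r else false) true n
  correctness : ∀ a n → Reflects (∀ m → length m < length n → P a m) (below a n)
  correctness a []      = ofʸ λ _ ()
  correctness a (tt ∷ n) with χ d (a , n) | reflects d (a , n)
  ... | false | ofⁿ ¬p = ofⁿ λ h → ¬p (h n (n<1+n _))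
  ... | true  | ofʸ p with below a n | correctness a n
  ...   | false | ofⁿ ¬h = ofⁿ λ h → ¬h λ m m<n → h m (m<n⇒m<1+n m<n)
  ...   | true  | ofʸ h = ofʸ (below-or-top n h p)

-- Unbounded search over a decidable relation

module _ {R : ⟦ A ⟧ → Fuel → Set} (d : Decidableᶜ {A ⊗ list unit} (λ (a , n) → R a n)) where
  private
    try : ⟦ A ⊗ list unit ⟧ → ⟦ (A ⊗ list unit) ⊕ unit ⟧
    try (a , n) = if χ d (a , n) then inj₂ tt else inj₁ (a , tt ∷ n)

    tryᶜ : Computable {A ⊗ list unit} {(A ⊗ list unit) ⊕ unit} try
    tryᶜ = ifᶜ (computes d) (inj₂ᶜ ttᶜ) (inj₁ᶜ (fstᶜ ,ᶜ ttᶜ ∷ᶜ sndᶜ))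

    Halts : ⟦ A ⊗ list unit ⟧ → Set
    Halts s = loop (Computable.code tryᶜ) · s ⇓ tt

    halts-at : ∀ {a n} → R a n → Halts (a , n)
    halts-at {a} {n} r with χ d (a , n) | reflects d (a , n) | Computable.correct tryᶜ (a , n)
    ... | true  | _      | c = done c
    ... | false | ofⁿ ¬r | _ = contradiction r ¬r

    -- Going back one index at a time: the test there either succeeds at once or passes on to the
    -- next index, where the search is known to halt.
    halts-earlier : ∀ {a} n → Halts (a , n) → Halts (a , [])
    halts-earlier         []       h = h
    halts-earlier {a = a} (tt ∷ n) h = halts-earlier n halts-before
      where
      halts-before : Halts (a , n)
      halts-before with χ d (a , n) | Computable.correct tryᶜ (a , n)
      ... | true  | c = done c
      ... | false | c = again c h

    -- Recursion on the halting derivation; determinism identifies each round recorded in it with a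
    -- round of `try`.
    found : ∀ {a n} → Halts (a , n) → ∃[ m ] R a m
    found {a} {n} h with χ d (a , n) | reflects d (a , n) | Computable.correct tryᶜ (a , n)
    ... | true | ofʸ r | _ = n , r
    found {a} {n} (again c h) | false | _ | c′
      with refl ← ⇓-deterministic c c′ = found h
    found {a} {n} (done c)    | false | _ | c′
      with () ← ⇓-deterministic c c′

  ∃-enumerable : ComputablyEnumerable {A} (λ a → ∃[ n ] R a n)
  ∃-enumerable = loop (Computable.code tryᶜ) ∘ ⟨ id , nil ⟩ , λ a → mk⇔
    (λ (n , r) → tt , comp (pair id nil) (halts-earlier n (halts-at r)))
    (λ { (tt , comp (pair id nil) h) → found h })

-- Strings

++ᶜ : {f g : ⟦ Γ ⟧ → List ⟦ A ⟧} → Computable {Γ} {list A} f → Computable {Γ} {list A} g →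
      Computable {Γ} {list A} (λ γ → f γ ++ g γ)
++ᶜ {f = f} {g} cf cg = computable-≗ (λ γ → fold-++ (g γ) (f γ))
  (paraᶜ (fstᶜ ∘ᶜ sndᶜ ∷ᶜ sndᶜ ∘ᶜ sndᶜ ∘ᶜ sndᶜ) cg cf)
  where
  fold-++ : {X : Set} (ys xs : List X) → para (λ x _ r → x ∷ r) ys xs ≡ xs ++ ys
  fold-++ ys []       = refl
  fold-++ ys (x ∷ xs) = cong (x ∷_) (fold-++ ys xs)

reverseᶜ : {f : ⟦ Γ ⟧ → List ⟦ A ⟧} → Computable {Γ} {list A} f → Computable {Γ} {list A} (λ γ → reverse (f γ))
reverseᶜ {f = f} cf = computable-≗ (λ γ → fold-reverse (f γ))
  (paraᶜ (++ᶜ (sndᶜ ∘ᶜ sndᶜ ∘ᶜ sndᶜ) (fstᶜ ∘ᶜ sndᶜ ∷ᶜ []ᶜ)) []ᶜ cf)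
  where
  fold-reverse : {X : Set} (xs : List X) → para (λ x _ r → r ∷ʳ x) [] xs ≡ reverse xs
  fold-reverse []       = refl
  fold-reverse (x ∷ xs) = trans (cong (_∷ʳ x) (fold-reverse xs)) (sym (unfold-reverse x xs))

uncons : {X : Set} → List X → ⊤ ⊎ (X × List X)
uncons = para (λ x xs _ → inj₂ (x , xs)) (inj₁ tt)

chop : Bool → Str → ⊤ ⊎ Str
chop b x = uncons x >>= λ (c , w) →
  if b then (if c then inj₂ w else inj₁ tt) else (if c then inj₁ tt else inj₂ w)

-- Since para consumes a list from its end, the prefix to be removed is given reversed.
strip : Str → Str → ⊤ ⊎ Str
strip z x = para (λ b _ r → r >>= chop b) (inj₂ x) z

chop-sound : ∀ b x {w} → chop b x ≡ inj₂ w → x ≡ b ∷ w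
chop-sound true  (true  ∷ x) refl = refl
chop-sound false (false ∷ x) refl = refl

chop-complete : ∀ b w → chop b (b ∷ w) ≡ inj₂ w
chop-complete true  w = refl
chop-complete false w = refl

reverse-∷-++ : ∀ (b : Bool) z w → reverse (b ∷ z) ++ w ≡ reverse z ++ b ∷ w
reverse-∷-++ b z w = trans (cong (_++ w) (unfold-reverse b z)) (++-assoc (reverse z) _ w)

strip-sound : ∀ z x {w} → strip z x ≡ inj₂ w → x ≡ reverse z ++ w
strip-sound []      x refl = refl
strip-sound (b ∷ z) x {w} eq with v , p , q ← >>=-inv (strip z x) eq =
  trans (strip-sound z x p) (trans (cong (reverse z ++_) (chop-sound b v q)) (sym (reverse-∷-++ b z w)))

strip-complete : ∀ z w → strip z (reverse z ++ w) ≡ inj₂ w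
strip-complete []      w = refl
strip-complete (b ∷ z) w = trans
  (cong (_>>= chop b) (trans (cong (strip z) (reverse-∷-++ b z w)) (strip-complete z (b ∷ w))))
  (chop-complete b w)

isPrefixOf⇒++ : ∀ {z x} → z isPrefixOf x → ∃[ w ] x ≡ z ++ w
isPrefixOf⇒++ []          = _ , refl
isPrefixOf⇒++ (refl ∷ p) with w , refl ← isPrefixOf⇒++ p = w , refl

isPrefixOf-++ : ∀ z {w} → z isPrefixOf (z ++ w)
isPrefixOf-++ []      = []
isPrefixOf-++ (b ∷ z) = refl ∷ isPrefixOf-++ z

isPrefixOf-trans : ∀ {x y z} → x isPrefixOf y → y isPrefixOf z → x isPrefixOf z
isPrefixOf-trans []          _          = []
isPrefixOf-trans (refl ∷ p) (refl ∷ q) = refl ∷ isPrefixOf-trans p q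

isPrefixOf-refl : ∀ {x} → x isPrefixOf x
isPrefixOf-refl {[]}    = []
isPrefixOf-refl {b ∷ x} = refl ∷ isPrefixOf-refl

isPrefixOf-antisym : ∀ {x y} → x isPrefixOf y → y isPrefixOf x → x ≡ y
isPrefixOf-antisym []          []         = refl
isPrefixOf-antisym (refl ∷ p) (refl ∷ q) = cong (_ ∷_) (isPrefixOf-antisym p q)

isPrefixOf-connex : ∀ {u v x} → u isPrefixOf x → v isPrefixOf x → u isPrefixOf v ⊎ v isPrefixOf u
isPrefixOf-connex []          _          = inj₁ []
isPrefixOf-connex (_ ∷ _)     []         = inj₂ []
isPrefixOf-connex (refl ∷ p) (refl ∷ q) with isPrefixOf-connex p q
... | inj₁ r = inj₁ (refl ∷ r)
... | inj₂ r = inj₂ (refl ∷ r)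

opaque
  isPrefixOfᵈ : Decidableᶜ {str ⊗ str} (λ (z , x) → z isPrefixOf x)
  isPrefixOfᵈ = record
    { computes = caseᶜ
        (paraᶜ (bindᶜ (sndᶜ ∘ᶜ sndᶜ ∘ᶜ sndᶜ)
                 (bindᶜ (paraᶜ (inj₂ᶜ (fstᶜ ∘ᶜ sndᶜ ,ᶜ fstᶜ ∘ᶜ sndᶜ ∘ᶜ sndᶜ)) (inj₁ᶜ ttᶜ) sndᶜ)
                   (ifᶜ (fstᶜ ∘ᶜ sndᶜ ∘ᶜ fstᶜ ∘ᶜ fstᶜ)
                     (ifᶜ (fstᶜ ∘ᶜ sndᶜ) (inj₂ᶜ (sndᶜ ∘ᶜ sndᶜ)) (inj₁ᶜ ttᶜ))
                     (ifᶜ (fstᶜ ∘ᶜ sndᶜ) (inj₁ᶜ ttᶜ) (inj₂ᶜ (sndᶜ ∘ᶜ sndᶜ))))))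
               (inj₂ᶜ sndᶜ) (reverseᶜ fstᶜ))
        (bitᶜ false) (bitᶜ true)
    ; reflects = λ (z , x) → correctness z x }
    where
    correctness : ∀ z x → Reflects (z isPrefixOf x)
                                   ([ (λ _ → false) , (λ _ → true) ] (strip (reverse z) x))
    correctness z x with strip (reverse z) x in eq
    ... | inj₂ w = ofʸ (subst (z isPrefixOf_)
      (sym (trans (strip-sound (reverse z) x eq) (cong (_++ w) (reverse-involutive z))))
      (isPrefixOf-++ z))
    ... | inj₁ tt = ofⁿ λ p → absurd p
      where
      absurd : ¬ (z isPrefixOf x)
      absurd p with w , refl ← isPrefixOf⇒++ p
               with () ← trans (sym eq) (trans (cong (strip (reverse z)) (cong (_++ w) (sym (reverse-involutive z))))
                                              (strip-complete (reverse z) w))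

opaque
  ≡ᵈ : Decidableᶜ {str ⊗ str} (λ (x , y) → x ≡ y)
  ≡ᵈ = ⇔ᵈ (λ _ → mk⇔ (λ (p , q) → isPrefixOf-antisym p q) (λ { refl → isPrefixOf-refl , isPrefixOf-refl }))
          (isPrefixOfᵈ ×ᵈ isPrefixOfᵈ ∘ᵈ (sndᶜ ,ᶜ fstᶜ))

_≟_ : (x y : Str) → Dec (x ≡ y)
x ≟ y = decide ≡ᵈ (x , y)

≡inj₂ᵈ : Decidableᶜ {(unit ⊕ str) ⊗ str} (λ (r , y) → r ≡ inj₂ y)
≡inj₂ᵈ = record
  { computes = caseᶜ fstᶜ (bitᶜ false) (computes ≡ᵈ ∘ᶜ (sndᶜ ,ᶜ sndᶜ ∘ᶜ fstᶜ))
  ; reflects = λ where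
      (inj₁ tt , y) → ofⁿ λ ()
      (inj₂ x  , y) → proof (map (mk⇔ (cong inj₂) (λ { refl → refl })) (x ≟ y)) }

∈ᵈ : Decidableᶜ {str ⊗ list str} (λ (p , us) → p ∈ us)
∈ᵈ = record
  { computes = paraᶜ (ifᶜ (computes ≡ᵈ ∘ᶜ (fstᶜ ∘ᶜ fstᶜ ,ᶜ fstᶜ ∘ᶜ sndᶜ)) (bitᶜ true) (sndᶜ ∘ᶜ sndᶜ ∘ᶜ sndᶜ))
                     (bitᶜ false) sndᶜ
  ; reflects = λ (p , us) → correctness p us }
  where
  member : Str → List Str → Bool
  member p us = para (λ u _ r → if does (p ≟ u) then true else r) false us
  correctness : ∀ p us → Reflects (p ∈ us) (member p us)
  correctness p [] = ofⁿ λ ()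
  correctness p (u ∷ us) with χ ≡ᵈ (p , u) | reflects ≡ᵈ (p , u)
  ... | true  | ofʸ eq = ofʸ (here eq)
  ... | false | ofⁿ p≢u with member p us | correctness p us
  ...   | true  | ofʸ p∈us = ofʸ (there p∈us)
  ...   | false | ofⁿ p∉us = ofⁿ λ { (here eq) → p≢u eq ; (there p∈us) → p∉us p∈us }

remove : Str → List Str → List Str
remove p = filter (λ u → ¬? (p ≟ u))

removeᶜ : Computable {str ⊗ list str} {list str} (λ (p , us) → remove p us)
removeᶜ = computable-≗ (λ (p , us) → fold-remove p us)
  (paraᶜ (ifᶜ (computes ≡ᵈ ∘ᶜ (fstᶜ ∘ᶜ fstᶜ ,ᶜ fstᶜ ∘ᶜ sndᶜ)) (sndᶜ ∘ᶜ sndᶜ ∘ᶜ sndᶜ)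
              (fstᶜ ∘ᶜ sndᶜ ∷ᶜ sndᶜ ∘ᶜ sndᶜ ∘ᶜ sndᶜ))
         []ᶜ sndᶜ)
  where
  fold-remove : ∀ p us → para (λ u _ r → if does (p ≟ u) then r else u ∷ r) [] us ≡ remove p us
  fold-remove p [] = refl
  fold-remove p (u ∷ us) with does (p ≟ u)
  ... | true  = fold-remove p us
  ... | false = cong (u ∷_) (fold-remove p us)

-- Enumerating strings and pairs

-- Binary digits, least significant first, with `false` worth 1 and `true` worth 2.
increment : Str → Str
increment = para (λ b w r → if b then false ∷ r else true ∷ w) (false ∷ [])

-- Bijective numeration: every string is reached from [] by incrementing.
string : Fuel → Str
string = para (λ _ _ → increment) []

stringᶜ : Computable {list unit} {str} string
stringᶜ = paraᶜ
  (paraᶜ (ifᶜ (fstᶜ ∘ᶜ sndᶜ) (bitᶜ false ∷ᶜ sndᶜ ∘ᶜ sndᶜ ∘ᶜ sndᶜ)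
                              (bitᶜ true ∷ᶜ fstᶜ ∘ᶜ sndᶜ ∘ᶜ sndᶜ))
         (bitᶜ false ∷ᶜ []ᶜ) (sndᶜ ∘ᶜ sndᶜ ∘ᶜ sndᶜ))
  []ᶜ idᶜ

-- Putting `false` in front takes the number n to 2n + 1, and one more increment gives `true` in
-- front, that is 2n + 2.
string-double : ∀ n → ∃[ m ] string m ≡ false ∷ string n
string-double []       = tt ∷ [] , refl
string-double (tt ∷ n) with m , eq ← string-double n =
  tt ∷ tt ∷ m , cong (λ w → increment (increment w)) eq

string-surjective : ∀ w → ∃[ n ] string n ≡ w
string-surjective []      = [] , refl
string-surjective (false ∷ w) with n , refl ← string-surjective w = string-double n
string-surjective (true ∷ w)  with n , refl ← string-surjective w with m , eq ← string-double n =
  tt ∷ m , cong increment eq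

-- Decodes t copies of `true`, one `false` and then `z` as the pair (z , t).
split : Str → Str × Fuel
split = para (λ b w (z , t) → if b then (z , tt ∷ t) else (w , [])) ([] , [])

splitᶜ : Computable {str} {str ⊗ list unit} split
splitᶜ = paraᶜ (ifᶜ (fstᶜ ∘ᶜ sndᶜ)
                 (fstᶜ ∘ᶜ sndᶜ ∘ᶜ sndᶜ ∘ᶜ sndᶜ ,ᶜ ttᶜ ∷ᶜ sndᶜ ∘ᶜ sndᶜ ∘ᶜ sndᶜ ∘ᶜ sndᶜ)
                 (fstᶜ ∘ᶜ sndᶜ ∘ᶜ sndᶜ ,ᶜ []ᶜ))
               ([]ᶜ ,ᶜ []ᶜ) idᶜ

split-surjective : ∀ z t → ∃[ w ] split w ≡ (z , t)
split-surjective z []       = false ∷ z , refl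
split-surjective z (tt ∷ t) with w , eq ← split-surjective z t =
  true ∷ w , cong (λ (z , t) → z , tt ∷ t) eq

item : Fuel → Str × Fuel
item n = split (string n)

itemᶜ : Computable {list unit} {str ⊗ list unit} item
itemᶜ = splitᶜ ∘ᶜ stringᶜ

item-surjective : ∀ z t → ∃[ n ] item n ≡ (z , t)
item-surjective z t with w , eq ← split-surjective z t with n , refl ← string-surjective w = n , eq

-- Thinning a partial function to incomparable arguments

Comparable : Str → Str → Set
Comparable u v = u isPrefixOf v ⊎ v isPrefixOf u

least : {P : Fuel → Set} → (∀ n → Dec (P n)) → ∀ {n} → P n →
        ∃[ m ] P m × (∀ k → length k < length m → ¬ P k)
least {P} P? {n} p = [ (λ below → n , p , below) , (λ found → found) ] (search n)
  where
  search : ∀ n → (∀ k → length k < length n → ¬ P k) ⊎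
                 ∃[ m ] P m × (∀ k → length k < length m → ¬ P k)
  search [] = inj₁ λ _ ()
  search (tt ∷ n) with search n
  ... | inj₂ found = inj₂ found
  ... | inj₁ below with P? n
  ...   | yes p = inj₂ (n , p , below)
  ...   | no ¬p = inj₁ (below-or-top n below ¬p)

module Restriction (G : Fn (str ⊗ str) str) where

  -- Prefix-freeness of the domain of G (p , _), in a form symmetric in the two arguments.
  Injective : Str → Set
  Injective p = ∀ {u v} → Comparable u v → G ↓ (p , u) → G ↓ (p , v) → u ≡ v

  argument : Fuel → Str
  argument n = proj₁ (item n)

  answer : Str → Fuel → ⊤ ⊎ Str
  answer p n = run G (proj₂ (item n)) (p , argument n)

  answerᶜ : Computable {str ⊗ list unit} {unit ⊕ str} (λ (p , n) → answer p n)
  answerᶜ = runᶜ G ∘ᶜ ((fstᶜ ,ᶜ fstᶜ ∘ᶜ itemᶜ ∘ᶜ sndᶜ) ,ᶜ sndᶜ ∘ᶜ itemᶜ ∘ᶜ sndᶜ)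

  answer-sound : ∀ {p n y} → answer p n ≡ inj₂ y → G · (p , argument n) ⇓ y
  answer-sound {n = n} = run-sound G (proj₂ (item n))

  answer-complete : ∀ {p z y} → G · (p , z) ⇓ y → ∃[ n ] argument n ≡ z × answer p n ≡ inj₂ y
  answer-complete {p} {z} {y} d with N , p∞ ← run-complete d
    with n , eq ← item-surjective z (replicate N tt) =
    n , cong proj₁ eq ,
    trans (cong (λ (z , t) → run G t (p , z)) eq)
          (p∞ (replicate N tt) (≤-reflexive (sym (length-replicate N))))

  Rival : Str × Str → Fuel → Set
  Rival (p , z) n = (∃[ y ] answer p n ≡ inj₂ y) × Comparable (argument n) z

  rivalᵈ : Decidableᶜ {(str ⊗ str) ⊗ list unit} (λ (a , n) → Rival a n)
  rivalᵈ = record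
    { computes = caseᶜ (answerᶜ ∘ᶜ (fstᶜ ∘ᶜ fstᶜ ,ᶜ sndᶜ)) (bitᶜ false) (bitᶜ true)
    ; reflects = λ ((p , z) , n) → defined (answer p n) }
    ×ᵈ (isPrefixOfᵈ ∘ᵈ (fstᶜ ∘ᶜ itemᶜ ∘ᶜ sndᶜ ,ᶜ sndᶜ ∘ᶜ fstᶜ)
        ⊎ᵈ isPrefixOfᵈ ∘ᵈ (sndᶜ ∘ᶜ fstᶜ ,ᶜ fstᶜ ∘ᶜ itemᶜ ∘ᶜ sndᶜ))
    where
    defined : {X : Set} (r : ⊤ ⊎ X) → Reflects (∃[ y ] r ≡ inj₂ y) ([ (λ _ → false) , (λ _ → true) ] r)
    defined (inj₁ tt) = ofⁿ λ ()
    defined (inj₂ y)  = ofʸ (y , refl)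

  -- Only the first conjunct mentions `x`, and it persists when `x` is extended; rivals are compared
  -- with the argument, not with `x`. Hence the mode is stable.
  Accepted : Str × Str × Str → Fuel → Set
  Accepted (p , x , y) n =
      argument n isPrefixOf x
    × answer p n ≡ inj₂ y
    × (∀ m → length m < length n → ¬ Rival (p , argument n) m)

  acceptedᵈ : Decidableᶜ {(str ⊗ str ⊗ str) ⊗ list unit} (λ (a , n) → Accepted a n)
  acceptedᵈ =
       isPrefixOfᵈ ∘ᵈ (fstᶜ ∘ᶜ itemᶜ ∘ᶜ sndᶜ ,ᶜ fstᶜ ∘ᶜ sndᶜ ∘ᶜ fstᶜ)
    ×ᵈ ≡inj₂ᵈ ∘ᵈ (answerᶜ ∘ᶜ (fstᶜ ∘ᶜ fstᶜ ,ᶜ sndᶜ) ,ᶜ sndᶜ ∘ᶜ sndᶜ ∘ᶜ fstᶜ)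
    ×ᵈ ∀<ᵈ (¬ᵈ rivalᵈ) ∘ᵈ ((fstᶜ ∘ᶜ fstᶜ ,ᶜ fstᶜ ∘ᶜ itemᶜ ∘ᶜ sndᶜ) ,ᶜ sndᶜ)

  -- Two prefixes of one `x` are comparable, so the earlier index would be a rival that rules out
  -- the later one.
  accepted-unique : ∀ {p x y y′ m n} → Accepted (p , x , y) m → Accepted (p , x , y′) n → m ≡ n
  accepted-unique {m = m} {n} (m≼x , m⇓ , m-first) (n≼x , n⇓ , n-first)
    with <-cmp (length m) (length n)
  ... | tri< m<n _ _ = contradiction ((_ , m⇓) , isPrefixOf-connex m≼x n≼x) (n-first m m<n)
  ... | tri≈ _ m≡n _ = unary-injective m n m≡n
  ... | tri> _ _ n<m = contradiction ((_ , n⇓) , isPrefixOf-connex n≼x m≼x) (m-first n n<m)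

  mode : DescriptionMode
  mode = record
    { D          = λ a → ∃[ n ] Accepted a n
    ; enumerable = ∃-enumerable acceptedᵈ
    ; functional = λ { (m , acc) (n , acc′) →
        inj₂-injective (trans (sym (proj₁ (proj₂ acc)))
          (trans (cong (answer _) (accepted-unique {m = m} {n} acc acc′)) (proj₁ (proj₂ acc′)))) }
    ; stable     = λ x≼x′ (n , n≼x , rest) → n , isPrefixOf-trans n≼x x≼x′ , rest }

  -- The first index with a value at an argument comparable with `z` has no earlier rivals.
  -- Injectivity makes its argument `z` itself, and determinism makes its value `y`.
  complete : ∀ {p x y z} → Injective p → z isPrefixOf x → G · (p , z) ⇓ y →
             DescriptionMode.D mode (p , x , y)
  complete {p} {x} {y} {z} injective z≼x d
    with n₀ , refl , eq₀ ← answer-complete d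
    with n , ((y′ , eq) , comparable) , first ←
         least (λ n → decide rivalᵈ ((p , z) , n)) {n₀} ((y , eq₀) , inj₁ isPrefixOf-refl)
    with z≡ ← injective comparable (_ , answer-sound {n = n} eq) (_ , d)
    = n , subst (_isPrefixOf x) (sym z≡) z≼x
        , trans eq (cong inj₂ (⇓-deterministic (answer-sound {n = n} eq) (subst (λ z → G · (p , z) ⇓ y) (sym z≡) d)))
        , subst (λ z → ∀ m → length m < length n → ¬ Rival (p , z) m) (sym z≡) first

-- Descriptions of programs as arguments of one partial function

module Evaluation (U : Fn (str ⊗ str) str) (V : Fn str str) where

  G : Fn (str ⊗ str) str
  G = U ∘ ⟨ V ∘ fst , snd ⟩

  open Restriction G using (Injective)

  evaluate : ∀ {p q z y} → V · p ⇓ q → U · (q , z) ⇓ y → G · (p , z) ⇓ y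
  evaluate Vp⇓ Uqz⇓ = comp (pair (comp fst Vp⇓) snd) Uqz⇓

  evaluate⁻¹ : ∀ {p q z} → V · p ⇓ q → G ↓ (p , z) → U ↓ (q , z)
  evaluate⁻¹ Vp⇓ (y , comp (pair (comp fst Vp⇓′) snd) Uqz⇓)
    with refl ← ⇓-deterministic Vp⇓ Vp⇓′ = y , Uqz⇓

  prefixFree⇒injective : ∀ {p q} → V · p ⇓ q → PrefixFree U q → Injective p
  prefixFree⇒injective Vp⇓ pf {u} {v} comparable u↓ v↓ with u ≟ v
  ... | yes u≡v = u≡v
  ... | no  u≢v with comparable
  ...   | inj₁ u≼v = contradiction (evaluate⁻¹ Vp⇓ u↓ , evaluate⁻¹ Vp⇓ v↓) (pf u≼v u≢v)
  ...   | inj₂ v≼u = contradiction (evaluate⁻¹ Vp⇓ v↓ , evaluate⁻¹ Vp⇓ u↓) (pf v≼u (λ eq → u≢v (sym eq)))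

-- Nodes of the binary tree and their siblings

length-∷ʳ : ∀ (w : Str) b → length (w ∷ʳ b) ≡ suc (length w)
length-∷ʳ w b = trans (length-++ w) (+-comm (length w) 1)

isPrefixOf-∷ʳ⁻ : ∀ {z} w {b} → z isPrefixOf (w ∷ʳ b) → z ≢ w ∷ʳ b → z isPrefixOf w
isPrefixOf-∷ʳ⁻ []      []               z≢ = []
isPrefixOf-∷ʳ⁻ []      (refl ∷ [])     z≢ = contradiction refl z≢
isPrefixOf-∷ʳ⁻ (b ∷ w) []               z≢ = []
isPrefixOf-∷ʳ⁻ (b ∷ w) (refl ∷ z≼)     z≢ = refl ∷ isPrefixOf-∷ʳ⁻ w z≼ (λ eq → z≢ (cong (b ∷_) eq))

∷ʳ-incomparable : ∀ w {x} → (w ∷ʳ false) isPrefixOf x → ¬ (w ∷ʳ true) isPrefixOf x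
∷ʳ-incomparable []      (refl ∷ _)  (() ∷ _)
∷ʳ-incomparable (_ ∷ w) (refl ∷ p) (refl ∷ q) = ∷ʳ-incomparable w p q

-- Only the length of the list matters: the depth below `a` counts the players still active, so
-- removing one moves the node up.
descend : Str → List Str → Str
descend a = para (λ _ _ w → w ∷ʳ false) a

-- The sibling of `descend a us`. The default `a` for an empty list does not arise in the game,
-- where each response comes with a member of `us`.
turn : Str → List Str → Str
turn a = para (λ _ us _ → descend a us ∷ʳ true) a

length-descend : ∀ a us → length (descend a us) ≡ length us + length a
length-descend a []       = refl
length-descend a (_ ∷ us) = trans (length-∷ʳ (descend a us) false) (cong suc (length-descend a us))

isPrefixOf-descend : ∀ a us → a isPrefixOf descend a us
isPrefixOf-descend a []       = isPrefixOf-refl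
isPrefixOf-descend a (_ ∷ us) = isPrefixOf-trans (isPrefixOf-descend a us) (isPrefixOf-++ _)

descend-cong : ∀ a us vs → length us ≡ length vs → descend a us ≡ descend a vs
descend-cong a []       []       _  = refl
descend-cong a (_ ∷ us) (_ ∷ vs) eq = cong (_∷ʳ false) (descend-cong a us vs (suc-injective eq))

descend-mono : ∀ a us vs → length us ≤ length vs → descend a us isPrefixOf descend a vs
descend-mono a us vs us≤vs with m≤n⇒m<n∨m≡n us≤vs
... | inj₂ us≡vs = subst (descend a us isPrefixOf_) (descend-cong a us vs us≡vs) isPrefixOf-refl
descend-mono a us (_ ∷ vs) _ | inj₁ (s≤s us≤vs) =
  isPrefixOf-trans (descend-mono a us vs us≤vs) (isPrefixOf-++ _)

isPrefixOf-turn : ∀ a us → a isPrefixOf turn a us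
isPrefixOf-turn a []       = isPrefixOf-refl
isPrefixOf-turn a (_ ∷ us) = isPrefixOf-trans (isPrefixOf-descend a us) (isPrefixOf-++ _)

length-turn : p ∈ us → length a < length (turn a us)
length-turn {us = _ ∷ us} {a} _ = subst (length a <_) (sym (length-∷ʳ (descend a us) true))
  (s≤s (length-mono (isPrefixOf-descend a us)))

-- A proper prefix of a node is a prefix of its parent, hence of its sibling.
isPrefixOf-descend⇒turn : p ∈ us → z isPrefixOf descend a us → z ≢ descend a us →
                          z isPrefixOf turn a us
isPrefixOf-descend⇒turn {us = _ ∷ us} _ z≼ z≢ =
  isPrefixOf-trans (isPrefixOf-∷ʳ⁻ (descend _ us) z≼ z≢) (isPrefixOf-++ _)

-- The path to `descend a vs` runs through `descend a us`, whose last bit is `false` where that of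
-- `turn a us` is `true`.
turn-incomparable : ∀ {x} → p ∈ us → length us ≤ length vs →
                    descend a vs isPrefixOf x → ¬ turn a us isPrefixOf x
turn-incomparable {us = u ∷ us} {vs} {a} _ us≤vs vs≼x =
  ∷ʳ-incomparable (descend a us) (isPrefixOf-trans (descend-mono a (u ∷ us) vs us≤vs) vs≼x)

length-remove : p ∈ us → length (remove p us) < length us
length-remove {p} {us} p∈us = filter-notAll (λ u → ¬? (p ≟ u)) us (lose p∈us (λ ¬eq → ¬eq refl))

∈-remove⁻ : ∀ {u} → u ∈ remove p us → u ∈ us
∈-remove⁻ {p} u∈ = proj₁ (∈-filter⁻ (λ u → ¬? (p ≟ u)) u∈)

∈-remove⁺ : ∀ p {u} → u ∈ us → p ≡ u ⊎ u ∈ remove p us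
∈-remove⁺ p {u} u∈us with p ≟ u
... | yes p≡u = inj₁ p≡u
... | no  p≢u = inj₂ (∈-filter⁺ (λ u → ¬? (p ≟ u)) u∈us p≢u)

-- All strings of length at most `b`, as the possible descriptions to be defeated.
adversaries : Fuel → List Str
adversaries = para (λ _ _ ws → para (λ w _ r → (false ∷ w) ∷ (true ∷ w) ∷ r) ([] ∷ []) ws) ([] ∷ [])

adversariesᶜ : Computable {list unit} {list str} adversaries
adversariesᶜ = paraᶜ
  (paraᶜ ((bitᶜ false ∷ᶜ fstᶜ ∘ᶜ sndᶜ) ∷ᶜ (bitᶜ true ∷ᶜ fstᶜ ∘ᶜ sndᶜ) ∷ᶜ sndᶜ ∘ᶜ sndᶜ ∘ᶜ sndᶜ)
         ([]ᶜ ∷ᶜ []ᶜ) (sndᶜ ∘ᶜ sndᶜ ∘ᶜ sndᶜ))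
  ([]ᶜ ∷ᶜ []ᶜ) idᶜ

∈-adversaries : ∀ b {p} → length p ≤ length b → p ∈ adversaries b
∈-adversaries []       {[]}    _       = here refl
∈-adversaries (tt ∷ b) {[]}    _       = []∈ (adversaries b)
  where
  []∈ : ∀ ws → [] ∈ para (λ w _ r → (false ∷ w) ∷ (true ∷ w) ∷ r) ([] ∷ []) ws
  []∈ []       = here refl
  []∈ (_ ∷ ws) = there (there ([]∈ ws))
∈-adversaries (tt ∷ b) {c ∷ p} (s≤s h) = extend c (∈-adversaries b h)
  where
  extend : ∀ c {w ws} → w ∈ ws → (c ∷ w) ∈ para (λ w _ r → (false ∷ w) ∷ (true ∷ w) ∷ r) ([] ∷ []) ws
  extend false (here refl) = here refl
  extend true  (here refl) = there (here refl)
  extend c     (there w∈)  = there (there (extend c w∈))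

marker : Fuel → Str
marker = para (λ _ _ w → true ∷ w) (false ∷ [])

marker-injective : ∀ b b′ {x} → marker b isPrefixOf x → marker b′ isPrefixOf x → b ≡ b′
marker-injective []       []        _           _           = refl
marker-injective []       (_ ∷ _)   (refl ∷ _) (() ∷ _)
marker-injective (_ ∷ _)  []        (refl ∷ _) (() ∷ _)
marker-injective (_ ∷ b)  (_ ∷ b′) (_ ∷ p)     (_ ∷ q)     =
  cong (tt ∷_) (marker-injective b b′ p q)
  
-- The game against all short descriptions

module Game (G : Fn (str ⊗ str) str) where

  open Restriction G using (Injective)

  -- The declared value, the players not yet excluded for good, and those among them still active
  -- against this value.
  position : Ty
  position = str ⊗ list str ⊗ list str

  Position : Set
  Position = ⟦ position ⟧

  value : Position → Str
  value (a , _) = a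

  players active : Position → List Str
  players (_ , ps , _) = ps
  active  (_ , _ , us) = us

  node : Position → Str
  node (a , _ , us) = descend a us

  -- After `divert` all remaining players become active again: an argument beyond the old node is
  -- incomparable with the new value, so it excludes nothing there.
  data Response : Position → Position → Set where
    retreat : ∀ {a ps us p} → p ∈ us → G · (p , descend a us) ⇓ a →
              Response (a , ps , us) (a , ps , remove p us)
    divert  : ∀ {a ps us p z} → p ∈ us → z isPrefixOf descend a us → z ≢ descend a us →
              G · (p , z) ⇓ a →
              Response (a , ps , us) (turn a us , remove p ps , remove p ps)

  candidate : Fuel → Str × Str × Fuel
  candidate n = let (w , t) = item n ; (z , i) = split w in string i , z , t

  Hit : Position → Str × Str × Fuel → Set
  Hit (a , ps , us) (p , z , t) = p ∈ us × z isPrefixOf descend a us × run G t (p , z) ≡ inj₂ a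

  nodeᶜ : Computable {position} {str} node
  nodeᶜ = paraᶜ (++ᶜ (sndᶜ ∘ᶜ sndᶜ ∘ᶜ sndᶜ) (bitᶜ false ∷ᶜ []ᶜ)) fstᶜ (sndᶜ ∘ᶜ sndᶜ)

  turnᶜ : Computable {position} {str} (λ (a , _ , us) → turn a us)
  turnᶜ = paraᶜ (++ᶜ (nodeᶜ ∘ᶜ (fstᶜ ∘ᶜ fstᶜ ,ᶜ []ᶜ ,ᶜ fstᶜ ∘ᶜ sndᶜ ∘ᶜ sndᶜ)) (bitᶜ true ∷ᶜ []ᶜ))
                fstᶜ (sndᶜ ∘ᶜ sndᶜ)

  candidateᶜ : Computable {list unit} {str ⊗ str ⊗ list unit} candidate
  candidateᶜ = (stringᶜ ∘ᶜ sndᶜ ∘ᶜ fstᶜ ,ᶜ fstᶜ ∘ᶜ fstᶜ ,ᶜ sndᶜ) ∘ᶜ (splitᶜ ∘ᶜ fstᶜ ,ᶜ sndᶜ) ∘ᶜ itemᶜ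

  candidate-surjective : ∀ p z t → ∃[ n ] candidate n ≡ (p , z , t)
  candidate-surjective p z t
    with i , refl ← string-surjective p
    with w , eq ← split-surjective z i
    with n , eq′ ← item-surjective w t =
    n , trans (cong (λ (w , t) → let (z , i) = split w in string i , z , t) eq′)
              (cong (λ (z , i) → string i , z , t) eq)

  hitᵈ : Decidableᶜ {position ⊗ str ⊗ str ⊗ list unit} (λ (c , k) → Hit c k)
  hitᵈ =
       ∈ᵈ ∘ᵈ (fstᶜ ∘ᶜ sndᶜ ,ᶜ sndᶜ ∘ᶜ sndᶜ ∘ᶜ fstᶜ)
    ×ᵈ isPrefixOfᵈ ∘ᵈ (fstᶜ ∘ᶜ sndᶜ ∘ᶜ sndᶜ ,ᶜ nodeᶜ ∘ᶜ fstᶜ)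
    ×ᵈ ≡inj₂ᵈ ∘ᵈ (runᶜ G ∘ᶜ ((fstᶜ ∘ᶜ sndᶜ ,ᶜ fstᶜ ∘ᶜ sndᶜ ∘ᶜ sndᶜ) ,ᶜ sndᶜ ∘ᶜ sndᶜ ∘ᶜ sndᶜ)
                   ,ᶜ fstᶜ ∘ᶜ fstᶜ)

  respond : Position → Str × Str × Fuel → Position
  respond (a , ps , us) (p , z , t) =
    if χ ≡ᵈ (z , descend a us) then a , ps , remove p us
                               else (turn a us , remove p ps , remove p ps)

  respondᶜ : Computable {position ⊗ str ⊗ str ⊗ list unit} {position} (λ (c , k) → respond c k)
  respondᶜ = ifᶜ (computes ≡ᵈ ∘ᶜ (fstᶜ ∘ᶜ sndᶜ ∘ᶜ sndᶜ ,ᶜ nodeᶜ ∘ᶜ fstᶜ))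
    (fstᶜ ∘ᶜ fstᶜ ,ᶜ fstᶜ ∘ᶜ sndᶜ ∘ᶜ fstᶜ ,ᶜ removeᶜ ∘ᶜ (fstᶜ ∘ᶜ sndᶜ ,ᶜ sndᶜ ∘ᶜ sndᶜ ∘ᶜ fstᶜ))
    (turnᶜ ∘ᶜ fstᶜ ,ᶜ removed ,ᶜ removed)
    where
    removed : Computable {position ⊗ str ⊗ str ⊗ list unit} {list str} (λ ((a , ps , us) , (p , z , t)) → remove p ps)
    removed = removeᶜ ∘ᶜ (fstᶜ ∘ᶜ sndᶜ ,ᶜ fstᶜ ∘ᶜ sndᶜ ∘ᶜ fstᶜ)

  respond-response : ∀ c k → Hit c k → Response c (respond c k)
  respond-response (a , ps , us) (p , z , t) (p∈us , z≼ , eq)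
    with χ ≡ᵈ (z , descend a us) | reflects ≡ᵈ (z , descend a us)
  ... | true  | ofʸ refl = retreat p∈us (run-sound G t eq)
  ... | false | ofⁿ z≢   = divert p∈us z≼ z≢ (run-sound G t eq)

  State : Set
  State = Position × Fuel

  -- The search restarts after a response: a candidate rejected before may be a hit now.
  tick : State → State
  tick (c , n) = if χ hitᵈ (c , candidate n) then (respond c (candidate n) , []) else (c , tt ∷ n)

  tickᶜ : Computable {position ⊗ list unit} {position ⊗ list unit} tick
  tickᶜ = ifᶜ (computes hitᵈ ∘ᶜ current) (respondᶜ ∘ᶜ current ,ᶜ []ᶜ) (fstᶜ ,ᶜ ttᶜ ∷ᶜ sndᶜ)
    where
    current : Computable {position ⊗ list unit} {position ⊗ str ⊗ str ⊗ list unit} (λ (c , n) → c , candidate n)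
    current = fstᶜ ,ᶜ candidateᶜ ∘ᶜ sndᶜ

  data Tick (c : Position) (n : Fuel) : State → Set where
    wait : ¬ Hit c (candidate n) → Tick c n (c , tt ∷ n)
    move : ∀ {c′} → Response c c′ → Tick c n (c′ , [])

  tick-view : ∀ c n → Tick c n (tick (c , n))
  tick-view c n with χ hitᵈ (c , candidate n) | reflects hitᵈ (c , candidate n)
  ... | true  | ofʸ hit  = move (respond-response c (candidate n) hit)
  ... | false | ofⁿ ¬hit = wait ¬hit

  start : Fuel → State
  start b = (marker b , adversaries b , adversaries b) , []

  play : Fuel → Fuel → State
  play b t = iterate tick t (start b)

  -- Stability

  -- What keeps declarations functional: while the value stays the node only moves up, and once a
  -- turn has left the subtree of `node c`, no later value is comparable with `node c`.
  data Consistent (c : Position) : Position → Set where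
    higher  : ∀ {ps us} → length us ≤ length (active c) → Consistent c (value c , ps , us)
    outside : ∀ {c′} → (∀ {x} → node c isPrefixOf x → ¬ value c′ isPrefixOf x) → Consistent c c′

  response-extends : ∀ {c c′} → Response c c′ → value c isPrefixOf value c′
  response-extends (retreat _ _)                = isPrefixOf-refl
  response-extends {c = a , _ , us} (divert _ _ _ _) = isPrefixOf-turn a us

  consistent-response : ∀ {c c′ c″} → Consistent c c′ → Response c′ c″ → Consistent c c″
  consistent-response (higher us≤) (retreat p∈us _) = higher (≤-trans (<⇒≤ (length-remove p∈us)) us≤)
  consistent-response {c} (higher us≤) (divert p∈us _ _ _) = outside (turn-incomparable {vs = active c} p∈us us≤)
  consistent-response (outside out) r =
    outside λ c≼x c″≼x → out c≼x (isPrefixOf-trans (response-extends r) c″≼x)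

  consistent-iterate : ∀ c n t → Consistent c (proj₁ (iterate tick t (c , n)))
  consistent-iterate c n [] = higher ≤-refl
  consistent-iterate c n (_ ∷ t)
    with iterate tick t (c , n) | consistent-iterate c n t
  ... | c′ , n′ | con with tick (c′ , n′) | tick-view c′ n′
  ...   | _ | wait _ = con
  ...   | _ | move r = consistent-response con r

  iterate-extends : ∀ c n t → value c isPrefixOf value (proj₁ (iterate tick t (c , n)))
  iterate-extends c n [] = isPrefixOf-refl
  iterate-extends c n (_ ∷ t)
    with iterate tick t (c , n) | iterate-extends c n t
  ... | c′ , n′ | ext with tick (c′ , n′) | tick-view c′ n′
  ...   | _ | wait _ = ext
  ...   | _ | move r = isPrefixOf-trans ext (response-extends r)

  value-isPrefixOf-node : ∀ c → value c isPrefixOf node c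
  value-isPrefixOf-node (a , _ , us) = isPrefixOf-descend a us

  iterate-+ : ∀ s t t′ → length t ≤ length t′ → ∃[ d ] iterate tick t′ s ≡ iterate tick d (iterate tick t s)
  iterate-+ s t t′ t≤t′ with m≤n⇒m<n∨m≡n t≤t′
  ... | inj₂ t≡t′ = [] , cong (λ t → iterate tick t s) (sym (unary-injective t t′ t≡t′))
  iterate-+ s t (_ ∷ t′) _ | inj₁ (s≤s t≤t′) with d , eq ← iterate-+ s t t′ t≤t′ =
    tt ∷ d , cong tick eq

  values-agree-later : ∀ b t t′ {x} → length t ≤ length t′ →
    node (proj₁ (play b t)) isPrefixOf x → node (proj₁ (play b t′)) isPrefixOf x →
    value (proj₁ (play b t)) ≡ value (proj₁ (play b t′))
  values-agree-later b t t′ t≤t′ ≼x ≼x′ with d , eq ← iterate-+ (start b) t t′ t≤t′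
    rewrite eq
    with iterate tick t (start b)
  ... | c , n with proj₁ (iterate tick d (c , n)) | consistent-iterate c n d
  ...   | _  | higher _    = refl
  ...   | c′ | outside out = contradiction (isPrefixOf-trans (value-isPrefixOf-node c′) ≼x′) (out ≼x)

  values-agree : ∀ b t t′ {x} →
    node (proj₁ (play b t)) isPrefixOf x → node (proj₁ (play b t′)) isPrefixOf x →
    value (proj₁ (play b t)) ≡ value (proj₁ (play b t′))
  values-agree b t t′ ≼x ≼x′ with ≤-total (length t) (length t′)
  ... | inj₁ t≤t′ = values-agree-later b t t′ t≤t′ ≼x ≼x′
  ... | inj₂ t′≤t = sym (values-agree-later b t′ t t′≤t ≼x′ ≼x)

  game : Fuel → Fuel
  game n = proj₂ (split (proj₁ (item n)))

  -- A single enumeration of the positions of all games at all times.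
  declared : Fuel → Position
  declared n = proj₁ (play (game n) (proj₂ (item n)))

  declaredᶜ : Computable {list unit} {position} declared
  declaredᶜ = fstᶜ ∘ᶜ paraᶜ (tickᶜ ∘ᶜ sndᶜ ∘ᶜ sndᶜ ∘ᶜ sndᶜ)
                            (startᶜ ∘ᶜ sndᶜ ∘ᶜ splitᶜ ∘ᶜ fstᶜ ∘ᶜ itemᶜ) (sndᶜ ∘ᶜ itemᶜ)
    where
    markerᶜ : Computable {list unit} {str} marker
    markerᶜ = paraᶜ (bitᶜ true ∷ᶜ sndᶜ ∘ᶜ sndᶜ ∘ᶜ sndᶜ) (bitᶜ false ∷ᶜ []ᶜ) idᶜ
    startᶜ : Computable {list unit} {position ⊗ list unit} start
    startᶜ = (markerᶜ ,ᶜ adversariesᶜ ,ᶜ adversariesᶜ) ,ᶜ []ᶜ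

  declared-surjective : ∀ b t → ∃[ n ] declared n ≡ proj₁ (play b t)
  declared-surjective b t
    with w , eq ← split-surjective [] b
    with n , eq′ ← item-surjective w t =
    n , trans (cong (λ (w , t) → proj₁ (play (proj₂ (split w)) t)) eq′)
              (cong (λ (_ , b) → proj₁ (play b t)) eq)

  declared-agree : ∀ m n {x} → node (declared m) isPrefixOf x → node (declared n) isPrefixOf x →
                   value (declared m) ≡ value (declared n)
  declared-agree m n = agree (game m) (game n) (proj₂ (item m)) (proj₂ (item n))
    where
    marked : ∀ b t {x} → node (proj₁ (play b t)) isPrefixOf x → marker b isPrefixOf x
    marked b t ≼x = isPrefixOf-trans (iterate-extends _ _ t)
      (isPrefixOf-trans (value-isPrefixOf-node (proj₁ (play b t))) ≼x)
    agree : ∀ b b′ t t′ {x} → node (proj₁ (play b t)) isPrefixOf x →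
            node (proj₁ (play b′ t′)) isPrefixOf x →
            value (proj₁ (play b t)) ≡ value (proj₁ (play b′ t′))
    agree b b′ t t′ ≼x ≼x′ with refl ← marker-injective b b′ (marked b t ≼x) (marked b′ t′ ≼x′) =
      values-agree b t t′ ≼x ≼x′

  -- The description is ignored, so each declared pair already has the empty description.
  Declares : Str × Str × Str → Fuel → Set
  Declares (_ , x , y) n = node (declared n) isPrefixOf x × value (declared n) ≡ y

  declaresᵈ : Decidableᶜ {(str ⊗ str ⊗ str) ⊗ list unit} (λ (a , n) → Declares a n)
  declaresᵈ =
       isPrefixOfᵈ ∘ᵈ (nodeᶜ ∘ᶜ declaredᶜ ∘ᶜ sndᶜ ,ᶜ fstᶜ ∘ᶜ sndᶜ ∘ᶜ fstᶜ)
    ×ᵈ ≡ᵈ ∘ᵈ (fstᶜ ∘ᶜ declaredᶜ ∘ᶜ sndᶜ ,ᶜ sndᶜ ∘ᶜ sndᶜ ∘ᶜ fstᶜ)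

  mode : DescriptionMode
  mode = record
    { D          = λ a → ∃[ n ] Declares a n
    ; enumerable = ∃-enumerable declaresᵈ
    ; functional = λ { (m , m≼x , refl) (n , n≼x , refl) → declared-agree m n m≼x n≼x }
    ; stable     = λ { x≼x′ (n , n≼x , eq) → n , isPrefixOf-trans n≼x x≼x′ , eq } }

  -- Termination

  -- A value shorter than the current one differs from it, and stays shorter since later values only
  -- extend `a`.
  Lost : Str → Str → Set
  Lost a p = ∃[ z ] ∃[ y ] z isPrefixOf a × G · (p , z) ⇓ y × length y < length a

  -- A prefix-free player with a value strictly beyond `x` has none at any prefix of `x`.
  Overshot : Str → Str → Set
  Overshot x p = ∃[ z ] x isPrefixOf z × length x < length z × G ↓ (p , z)

  -- Each initial player is still available or has a reason why it cannot cover the position. `Lost`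
  -- lasts for good, `Overshot` until the next turn. By `subset`, a diverting player really leaves
  -- `players`.
  record Invariant (A : List Str) (c : Position) : Set where
    field
      permanent : ∀ {p} → p ∈ A → p ∈ players c ⊎ Lost (value c) p
      current   : ∀ {p} → p ∈ A → p ∈ active c ⊎ Lost (value c) p ⊎ Overshot (node c) p
      subset    : ∀ {p} → p ∈ active c → p ∈ players c

  Lost-extend : ∀ {a a′ p} → a isPrefixOf a′ → Lost a p → Lost a′ p
  Lost-extend a≼a′ (z , y , z≼a , d , y<a) =
    z , y , isPrefixOf-trans z≼a a≼a′ , d , <-≤-trans y<a (length-mono a≼a′)

  invariant-response : ∀ {A c c′} → Response c c′ → Invariant A c → Invariant A c′
  invariant-response {A} (retreat {a} {ps} {us} {p} p∈us d) inv = record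
    { permanent = permanent
    ; current   = update
    ; subset    = λ u∈ → subset (∈-remove⁻ u∈) }
    where
    open Invariant inv
    shorter : length (descend a (remove p us)) < length (descend a us)
    shorter rewrite length-descend a (remove p us) | length-descend a us =
      +-monoˡ-< (length a) (length-remove p∈us)
    above : descend a (remove p us) isPrefixOf descend a us
    above = descend-mono a (remove p us) us (<⇒≤ (length-remove p∈us))
    update : ∀ {u} → u ∈ A → u ∈ remove p us ⊎ Lost a u ⊎ Overshot (descend a (remove p us)) u
    update u∈A with current u∈A
    ... | inj₂ (inj₁ lost) = inj₂ (inj₁ lost)
    ... | inj₂ (inj₂ (z , x≼z , x<z , z↓)) =
      inj₂ (inj₂ (z , isPrefixOf-trans above x≼z , ≤-<-trans (<⇒≤ shorter) x<z , z↓))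
    ... | inj₁ u∈us with ∈-remove⁺ p u∈us
    -- The retreating player has a value at the old node, strictly beyond the new one.
    ...   | inj₁ refl = inj₂ (inj₂ (descend a us , above , shorter , a , d))
    ...   | inj₂ u∈ = inj₁ u∈
  invariant-response {A} (divert {a} {ps} {us} {p} {z} p∈us z≼ z≢ d) inv = record
    { permanent = update
    ; current   = λ u∈A → [ inj₁ , (λ lost → inj₂ (inj₁ lost)) ] (update u∈A)
    ; subset    = λ u∈ → u∈ }
    where
    open Invariant inv
    update : ∀ {u} → u ∈ A → u ∈ remove p ps ⊎ Lost (turn a us) u
    update u∈A with permanent u∈A
    ... | inj₂ lost = inj₂ (Lost-extend (isPrefixOf-turn a us) lost)
    ... | inj₁ u∈ps with ∈-remove⁺ p u∈ps
    -- The argument of the diverting player is still a prefix of the new value, and its answer, the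
    -- old value, is shorter.
    ...   | inj₁ refl = inj₂ (z , a , isPrefixOf-descend⇒turn p∈us z≼ z≢ , d , length-turn p∈us)
    ...   | inj₂ u∈ = inj₁ u∈

  Covered : List Str → Position → Set
  Covered A c = ∃[ p ] p ∈ A × Injective p × ∃[ z ] z isPrefixOf node c × G · (p , z) ⇓ value c

  -- An inactive player cannot cover. If lost, its two arguments are prefixes of the node, hence
  -- equal, and the current value would be shorter than itself. If overshot, one argument would lie
  -- both within and strictly beyond the node.
  active-cover : ∀ {A c} → Invariant A c → Covered A c →
           ∃[ p ] p ∈ active c × ∃[ z ] z isPrefixOf node c × G · (p , z) ⇓ value c
  active-cover {c = c} inv (p , p∈A , injective , z , z≼x , d) with Invariant.current inv p∈A
  ... | inj₁ p∈us = p , p∈us , z , z≼x , d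
  ... | inj₂ (inj₁ (z′ , y , z′≼a , d′ , y<a))
    with refl ← injective (isPrefixOf-connex z≼x (isPrefixOf-trans z′≼a (value-isPrefixOf-node c))) (_ , d) (_ , d′)
    with refl ← ⇓-deterministic d d′ = contradiction y<a (<-irrefl refl)
  ... | inj₂ (inj₂ (z′ , x≼z′ , x<z′ , z′↓))
    with refl ← injective (inj₁ (isPrefixOf-trans z≼x x≼z′)) (_ , d) z′↓ =
    contradiction (<-≤-trans x<z′ (length-mono z≼x)) (<-irrefl refl)

  AlwaysCovered : List Str → State → Set
  AlwaysCovered A s = ∀ t → Covered A (proj₁ (iterate tick t s))

  always-tick : ∀ {A} s → AlwaysCovered A s → AlwaysCovered A (tick s)
  always-tick s always t = subst (λ s → Covered _ (proj₁ s)) (iterate-step tick t s) (always (tt ∷ t))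

  -- The known hit at `m` bounds the wait: it is tested after `d` further ticks unless another hit
  -- comes first.
  eventual-response : ∀ {A} c n d m → m ≡ d ++ n → Hit c (candidate m) → AlwaysCovered A (c , n) →
                      ∃[ c′ ] Response c c′ × AlwaysCovered A (c′ , [])
  eventual-response c n d m eq hit always with tick (c , n) | tick-view c n | always-tick (c , n) always
  eventual-response c n d        m eq   hit _ | _ | move r    | always′ = _ , r , always′
  eventual-response c n []       m refl hit _ | _ | wait ¬hit | always′ = contradiction hit ¬hit
  eventual-response c n (tt ∷ d) m eq   hit _ | _ | wait ¬hit | always′ =
    eventual-response c (tt ∷ n) d m (trans eq (shift d)) hit always′
    where
    shift : ∀ d → tt ∷ (d ++ n) ≡ d ++ tt ∷ n
    shift []      = refl
    shift (tt ∷ d) = cong (tt ∷_) (shift d)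

  next-response : ∀ {A c} → Invariant A c → AlwaysCovered A (c , []) →
                  ∃[ c′ ] Response c c′ × AlwaysCovered A (c′ , [])
  next-response {c = c} inv always
    with p , p∈us , z , z≼x , d ← active-cover inv (always [])
    with N , p∞ ← run-complete d
    with n , eq ← candidate-surjective p z (replicate N tt) =
    eventual-response c [] n n (sym (++-identityʳ n))
      (subst (Hit c) (sym eq) (p∈us , z≼x , p∞ _ (≤-reflexive (sym (length-replicate N))))) always

  -- Lexicographic induction: `retreat` lowers the number of active players, while `divert` lowers
  -- the number of all players and resets the former.
  refute : ∀ {A} m k c → length (players c) ≤ m → length (active c) ≤ k →
           Invariant A c → ¬ AlwaysCovered A (c , [])
  refute m k c ps≤m us≤k inv always with next-response inv always
  refute m zero    _ ps≤m us≤k inv always | _ , retreat p∈us _ , _ with () ← <-≤-trans (length-remove p∈us) us≤k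
  refute m (suc k) _ ps≤m us≤k inv always | c′ , r@(retreat p∈us _) , always′ =
    refute m k c′ ps≤m (s≤s⁻¹ (<-≤-trans (length-remove p∈us) us≤k)) (invariant-response r inv) always′
  refute zero k _ ps≤m us≤k inv always | c′ , r@(divert p∈us _ _ _) , always′
    with () ← <-≤-trans (length-remove (Invariant.subset inv p∈us)) ps≤m
  refute (suc m) k _ ps≤m us≤k inv always | c′ , r@(divert p∈us _ _ _) , always′ =
    refute m _ c′ (s≤s⁻¹ (<-≤-trans (length-remove (Invariant.subset inv p∈us)) ps≤m)) ≤-refl
      (invariant-response r inv) always′

  not-always-covered : ∀ b → ¬ AlwaysCovered (adversaries b) (start b)
  not-always-covered b = refute _ _ _ ≤-refl ≤-refl record
    { permanent = inj₁ ; current = inj₁ ; subset = λ p∈ → p∈ }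

theorem8 : (M : DescriptionMode) → OptimalMode M →
    (U : Fn (str ⊗ str) str) → StandardLanguage U →
    (V : Fn str str) → OptimalDecompressor V →
    (∃[ c ] (∀ (x y : Str) → min C[ M ] y x ≤min C′[ U , V ] y x + c))
    × (Σ[ x ∈ (ℕ → Str) ] Σ[ y ∈ (ℕ → Str) ]
    (Bounded (λ (i : ℕ) → C[ M ] (y i) (x i))
    × Unbounded (λ (i : ℕ) → C′[ U , V ] (y i) (x i))))
theorem8 M optimal U _ V _ = upper , x , y , bounded , unbounded
  where
  open Evaluation U V

  upper : ∃[ c ] (∀ (x y : Str) → min C[ M ] y x ≤min C′[ U , V ] y x + c)
  -- A description of `q` under `V` is itself a description in the restricted mode, so the constant
  -- of optimality suffices.
  upper with c , M≤ ← optimal (Restriction.mode G) = c , λ where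
    x y n (k , (q , pf , (z , z≼x , Uqz⇓) , p , Vp⇓ , p≡k) , k≤n) →
      M≤ x y n (k , (p , Restriction.complete G (prefixFree⇒injective Vp⇓ pf) z≼x
                           (evaluate Vp⇓ Uqz⇓) , p≡k) , k≤n)

  open Game G

  -- All declarations are listed, not only the uncovered ones; `Bounded` holds for every
  -- declaration, and game `b` defeats the bound `b`.
  x y : ℕ → Str
  x i = node (declared (replicate i tt))
  y i = value (declared (replicate i tt))

  bounded : Bounded (λ i → C[ M ] (y i) (x i))
  bounded with c , M≤ ← optimal mode = c , λ i →
    M≤ (x i) (y i) 0 (0 , ([] , (replicate i tt , isPrefixOf-refl , refl) , refl) , z≤n)

  -- A bound `b` would give, for each position of game `b`, a prefix-free covering program with a
  -- description of length at most `b`, hence among the adversaries.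
  unbounded : Unbounded (λ i → C′[ U , V ] (y i) (x i))
  unbounded (b , C′≤b) = not-always-covered (replicate b tt) covered
    where
    covered : AlwaysCovered (adversaries (replicate b tt)) (start (replicate b tt))
    covered t
      with n , eq ← declared-surjective (replicate b tt) t
      with k , (q , pf , (z , z≼x , Uqz⇓) , p , Vp⇓ , refl) , p≤b ← C′≤b (length n) =
      subst (Covered (adversaries (replicate b tt)))
            (trans (cong declared (unary-injective (replicate (length n) tt) n (length-replicate (length n)))) eq)
        (p , ∈-adversaries (replicate b tt) (≤-trans p≤b (≤-reflexive (sym (length-replicate b))))
           , prefixFree⇒injective Vp⇓ pf , z , z≼x , evaluate Vp⇓ Uqz⇓)
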